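{- Let $d\geq 1$ and $q\geq 2$ be integers, and let $\mathcal M$ be an orientably regular embedding of the $d$-dimensional Hamming graph $H(d,q)$. Then $q$ is a prime power, and if $q>2$ then $\mathcal M$ is isomorphic to a Hamming map $\mathcal H(d,\omega)$ for some generator $\omega$ of the multiplicative group $F_q^*$.
   Context: The Hamming graph $H(d,q)$ has vertex set $Q^d$, where $Q$ is a set with $q$ elements, two vertices $(v_i)$ and $(w_i)$ being adjacent iff $v_i\neq w_i$ for exactly one index $i$. A map is a 2-cell embedding of a connected graph in a compact oriented surface; it is orientably regular if its group $\mathrm{Aut}^+\mathcal M$ of orientation-preserving automorphisms acts transitively on the arcs (directed edges). An orientably regular embedding of a graph $\Gamma$ is an orientably regular map whose underlying graph is isomorphic to $\Gamma$. Maps are isomorphic if there is an orientation-preserving isomorphism between them. Hamming maps: let $q$ be a prime power, $F_q$ the field with $q$ elements, $n=d(q-1)$, $V=F_q^d$ (row vectors) with standard basis $e_1,\dots,e_d$. For a generator $\omega$ of $F_q^*$ let $M_\omega$ be the $d\times d$ matrix with entries $m_{i,i+1}=1$ for $1\le i\le d-1$, $m_{d,1}=\omega$, and all other entries $0$. The Hamming map $\mathcal H(d,\omega)$ is the Cayley map of the additive group $V$ with respect to the generating set $S=\{\lambda e_i:\lambda\in F_q^*,1\le i\le d\}$ (so its graph is $H(d,q)$ with $Q=F_q$), in which the rotation at every vertex $v$ sends the neighbour $v+e_1M_\omega^{i}$ to $v+e_1M_\omega^{i+1}$ (indices mod $n$); i.e. the cyclic order of neighbours of $v$ is $v+e_1,v+e_2,\dots,v+e_d,v+\omega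 e_1,\dots,v+\omega^{q-2}e_d$. -}

module Defs where

open import Data.Nat using (ℕ; zero; suc; _^_)
open import Data.Fin using (Fin)
open import Data.Vec using (Vec; []; _∷_; lookup; zipWith; map; last; init)
open import Data.Product using (Σ; ∃; _×_; _,_)
open import Relation.Binary.PropositionalEquality using (_≡_; _≢_)
open import Relation.Nullary using (¬_)
open import Data.Nat.Primality using (Prime)
open import Algebra.Structures using (IsCommutativeRing)

iter : {A : Set} → (A → A) → ℕ → A → A
iter f zero x = x
iter f (suc k) x = f (iter f k x)

Vert : ℕ → ℕ → Set
Vert d q = Vec (Fin q) d

Adj : {d q : ℕ} → Vert d q → Vert d q → Set
Adj {d} v w = Σ (Fin d) λ i → (lookup v i ≢ lookup w i) × (∀ j → j ≢ i → lookup v j ≡ lookup w j)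

-- Oriented maps with underlying graph H(d,q), given combinatorially by a
-- rotation system: at each vertex v a cyclic permutation ρ v of the
-- neighbours of v.  Darts are the arcs (v , w) with Adj v w.

record RotationSystem (d q : ℕ) : Set where
  field
    ρ     : Vert d q → Vert d q → Vert d q
    ρ-adj : ∀ v w → Adj v w → Adj v (ρ v w)
    ρ-inj : ∀ v w w′ → Adj v w → Adj v w′ → ρ v w ≡ ρ v w′ → w ≡ w′
    ρ-cyc : ∀ v w w′ → Adj v w → Adj v w′ → ∃ λ k → iter (ρ v) k w ≡ w′

open RotationSystem public

record GraphAut (d q : ℕ) : Set where
  field
    to      : Vert d q → Vert d q
    from    : Vert d q → Vert d q
    to-from : ∀ v → to (from v) ≡ v
    from-to : ∀ v → from (to v) ≡ v
    to-adj  : ∀ v w → Adj v w → Adj (to v) (to w)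
    from-adj : ∀ v w → Adj v w → Adj (from v) (from w)

open GraphAut public

MapIso : {d q : ℕ} → RotationSystem d q → RotationSystem d q → Set
MapIso {d} {q} M M′ = Σ (GraphAut d q) λ φ →
  ∀ v w → Adj v w → to φ (ρ M v w) ≡ ρ M′ (to φ v) (to φ w)

OrientablyRegular : {d q : ℕ} → RotationSystem d q → Set
OrientablyRegular {d} {q} M = ∀ v w v′ w′ → Adj v w → Adj v′ w′ →
  Σ (MapIso M M) λ φ → (to (Σ.proj₁ φ) v ≡ v′) × (to (Σ.proj₁ φ) w ≡ w′)

IsPrimePower : ℕ → Set
IsPrimePower q = ∃ λ p → ∃ λ k → Prime p × q ≡ p ^ k

record FieldOn (q : ℕ) : Set where
  field
    _+_ _*_ : Fin q → Fin q → Fin q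
    -_      : Fin q → Fin q
    0# 1#   : Fin q
    isCommutativeRing : IsCommutativeRing _≡_ _+_ _*_ -_ 0# 1#
    0≢1     : 0# ≢ 1#
    inverse : ∀ x → x ≢ 0# → ∃ λ y → x * y ≡ 1#

  _^′_ : Fin q → ℕ → Fin q
  x ^′ zero = 1#
  x ^′ suc k = x * (x ^′ k)

open FieldOn public

IsGenerator : {q : ℕ} → FieldOn q → Fin q → Set
IsGenerator F ω = (ω ≢ 0# F) × (∀ x → x ≢ 0# F → ∃ λ k → _^′_ F ω k ≡ x)

vadd vsub : {q d : ℕ} → FieldOn q → Vec (Fin q) d → Vec (Fin q) d → Vec (Fin q) d
vadd F = zipWith (_+_ F)
vsub F u v = zipWith (_+_ F) u (map (-_ F) v)

-- s ↦ s M_ω  (row vector times M_ω): (s M_ω)_1 = ω s_d, (s M_ω)_{j} = s_{j-1}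
mulM : {q d : ℕ} → FieldOn q → Fin q → Vec (Fin q) d → Vec (Fin q) d
mulM {d = zero} F ω s = s
mulM {d = suc n} F ω s = _*_ F ω (last s) ∷ init s

-- The Hamming map H(d,ω): Cayley map of V w.r.t. S = {λ e_i}, rotation
-- v + s ↦ v + s M_ω
hammingRot : {d q : ℕ} → FieldOn q → Fin q → Vert d q → Vert d q → Vert d q
hammingRot F ω v w = vadd F v (mulM F ω (vsub F w v))

record IsHammingMap {d q : ℕ} (F : FieldOn q) (ω : Fin q) (M : RotationSystem d q) : Set where
  field
    rot-eq : ∀ v w → Adj v w → ρ M v w ≡ hammingRot F ω v w

{-# OPTIONS --safe #-}
-- In a regular embedding M an automorphism is determined by the image of one
-- arc, so the stabiliser of a vertex v₀ is cyclic, generated by the rotation x at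
-- v₀.  Automorphisms of H(d,q) permute the d directions and act coordinatewise.
--
-- Fix a line K through v₀.  Its setwise stabiliser acts sharply 2-transitively
-- on K with an abelian point stabiliser.  In such a group any two fixed-point-free
-- elements commute, so together with the identity they form a regular abelian
-- normal subgroup; taking this as addition and the stabiliser of v₀ as
-- multiplication makes K a field F, and ω is the effect of xᵈ on K.
--
-- If q > 2 the translations of K are commutators of translations and scalings, and
-- so preserve all directions; by regularity they then fix all the coordinates
-- other than that of K.  Their conjugates under x generate a group acting on the
-- vertices as the additive group of F^d, and transporting F from K to the other
-- directions by the powers of x turns x into s ↦ s M_ω.
module Submission where

open import Defs hiding (_+_; _*_; -_; 0#; 1#)
open import Data.Nat using (ℕ; _≤_; _<_)
open import Data.Product using (Σ; ∃; _×_)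
import Algebra.Properties.Semiring.Mult
open import Algebra.Bundles using (CommutativeRing)
open import Algebra.Structures using (IsCommutativeRing)
open import Data.Fin
  using (Fin; zero; suc; toℕ; fromℕ; fromℕ<; inject₁; punchOut; remQuot; combine)
open import Data.Fin.Properties
  using (_≟_; any?; all?; ¬∀⟶∃¬; pigeonhole; injective⇒≤; punchOut-injective; toℕ-injective; toℕ<n;
         toℕ-fromℕ; toℕ-fromℕ<; toℕ-inject₁; remQuot-combine; combine-remQuot)
open import Data.List.Relation.Unary.All using (All; []; _∷_)
open import Data.Nat as ℕ using (zero; suc; _^_; NonZero)
open import Data.Nat.Coprimality using (coprime-Bézout; prime⇒coprime)
import Data.Nat.DivMod as ℕ
open import Data.Nat.GCD using (module Bézout)
open import Data.Nat.ListAction using (product)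
open import Data.Nat.Primality using (Prime; prime[2]; prime⇒nonZero; prime⇒nonTrivial)
open import Data.Nat.Primality.Factorisation using (factorise; module PrimeFactorisation)
import Data.Nat.Properties as ℕₚ
open import Data.List.Base using ([]; _∷_)
open import Data.Product using (_,_; proj₁; proj₂)
open import Data.Sum using (_⊎_; inj₁; inj₂)
open import Data.Vec
  using (Vec; []; _∷_; lookup; tabulate; replicate; last; init; _[_]≔_)
open import Data.Vec.Properties
  using (tabulate∘lookup; tabulate-cong; lookup∘tabulate; lookup∘update; lookup∘update′; []≔-lookup;
         []≔-idempotent; []≔-commutes; lookup-zipWith; lookup-map; lookup-replicate)
open import Function using (_∘_)
open import Relation.Binary.Definitions using (tri<; tri≈; tri>)
open import Relation.Binary.PropositionalEquality
open import Relation.Nullary using (¬_; Dec; yes; no; contradiction)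

-- Finite sharply 2-transitive groups

-- The equation u + c = m c, solvable whenever m is not 1, is used twice. It makes a translation of
-- K a commutator with the scaling by m; this takes a scaling other than the identity, which is why
-- q = 2 is set apart. Preserving directions still leaves a translation free to permute the values
-- of another coordinate. At a given value, such a permutation is matched by an automorphism fixing
-- v₀; if this is not the identity, it scales K and so meets the translation at a solution of the
-- same equation, where rigidity identifies the two.
--
-- The exponent d in xᵈ comes from x permuting the d directions in a single cycle: xᵈ is the first
-- power of x to return to K, and ω records what it does there.
--
-- The Hamming map is not built separately and then compared with M. Instead M is pulled back along
-- the new coordinates; the result is a rotation system isomorphic to M by construction, and only
-- the formula for its rotation has to be checked.

Inj : {A B : Set} → (A → B) → Set
Inj f = ∀ {x y} → f x ≡ f y → x ≡ y

-- A missed value could be punched out of the codomain, leaving an injection into a smaller finite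
-- set.
inj⇒surj : ∀ {n} (f : Fin n → Fin n) → Inj f → ∀ y → ∃ λ x → f x ≡ y
inj⇒surj {suc n} f f-inj y with any? (λ x → f x ≟ y)
... | yes hit = hit
... | no miss = contradiction (injective⇒≤ g-inj) ℕₚ.1+n≰n
  where
  y≢ : ∀ x → y ≢ f x
  y≢ x eq = miss (x , sym eq)
  g : Fin (suc n) → Fin n
  g x = punchOut (y≢ x)
  g-inj : Inj g
  g-inj {a} {b} eq = f-inj (punchOut-injective (y≢ a) (y≢ b) eq)

-- If every value were attained, a section of `f` would be injective, hence bijective, hence a
-- two-sided inverse, and `f` could not identify `a` with `b`.
collision⇒miss : ∀ {n} (f : Fin n → Fin n) {a b} → a ≢ b → f a ≡ f b →
  ∃ λ y → ∀ x → f x ≢ y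
collision⇒miss {n} f {a} {b} a≢b fa≡fb with all? (λ y → any? (λ x → f x ≟ y))
... | no ¬onto with ¬∀⟶∃¬ n _ (λ y → any? (λ x → f x ≟ y)) ¬onto
...   | y , miss = y , λ x eq → miss (x , eq)
collision⇒miss {n} f {a} {b} a≢b fa≡fb | yes onto =
  contradiction (trans (sym (s-f a)) (trans (cong s fa≡fb) (s-f b))) a≢b
  where
  s : Fin n → Fin n
  s y = proj₁ (onto y)
  f-s : ∀ y → f (s y) ≡ y
  f-s y = proj₂ (onto y)
  s-inj : Inj s
  s-inj {x} {y} eq = trans (sym (f-s x)) (trans (cong f eq) (f-s y))
  s-f : ∀ x → s (f x) ≡ x
  s-f x with inj⇒surj s s-inj x
  ... | y , refl = cong s (f-s y)

-- All laws are stated through the action. The elements of `G` will be automorphisms bundled with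
-- proofs, so they are compared only by their effect on points.
record Sharply2Transitive (q : ℕ) : Set₁ where
  infixr 8 _·_
  infixl 9 _∙_
  field
    G      : Set
    _·_    : G → Fin q → Fin q
    _∙_    : G → G → G
    ι      : G
    _⁻¹    : G → G
    ∙-act  : ∀ g h x → (g ∙ h) · x ≡ g · h · x
    ι-act  : ∀ x → ι · x ≡ x
    ⁻¹-actˡ : ∀ g x → (g ⁻¹) · g · x ≡ x
    ⁻¹-actʳ : ∀ g x → g · (g ⁻¹) · x ≡ x
    trans₂ : ∀ {a b c d} → a ≢ b → c ≢ d → ∃ λ g → g · a ≡ c × g · b ≡ d
    sharp  : ∀ {g h a b} → a ≢ b → g · a ≡ h · a → g · b ≡ h · b → ∀ x → g · x ≡ h · x
    𝟘 𝟙    : Fin q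
    𝟘≢𝟙    : 𝟘 ≢ 𝟙
    stabilizer-comm : ∀ g h → g · 𝟘 ≡ 𝟘 → h · 𝟘 ≡ 𝟘 → ∀ x → g · h · x ≡ h · g · x

module NearField {q : ℕ} (S : Sharply2Transitive q) where
  open Sharply2Transitive S public

  infix 4 _≗·_
  _≗·_ : G → G → Set
  g ≗· h = ∀ x → g · x ≡ h · x

  act-inj : ∀ g → Inj (g ·_)
  act-inj g {x} {y} eq =
    trans (sym (⁻¹-actˡ g x)) (trans (cong (g ⁻¹ ·_) eq) (⁻¹-actˡ g y))

  sharp-id : ∀ {g a b} → a ≢ b → g · a ≡ a → g · b ≡ b → ∀ x → g · x ≡ x
  sharp-id {g} {a} {b} a≢b ga gb x =
    trans (sharp {g} {ι} a≢b (trans ga (sym (ι-act a))) (trans gb (sym (ι-act b))) x) (ι-act x)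

  FixedPointFree : G → Set
  FixedPointFree g = ∀ x → g · x ≢ x

  -- For c ∉ {a, b} let gᶜ be the element fixing c with a ↦ b.  Then c ↦ gᶜ·c₀
  -- is injective, and it misses g·c₀ for each fixed-point-free g with a ↦ b.
  -- The image has q − 2 points in Q ∖ {b}, so there is room for just one g.
  fpf-unique : ∀ {g g′} → FixedPointFree g → FixedPointFree g′ →
    ∀ {a} → g · a ≡ g′ · a → g ≗· g′
  fpf-unique {g} {g′} fg fg′ {a} eq c₀ with g · c₀ ≟ g′ · c₀
  ... | yes p = p
  ... | no ≢c₀ = contradiction (inj⇒surj F F-inj (g′ · c₀)) (λ (c , Fc) → F-miss c Fc)
    where
    b = g · a
    b≢a : b ≢ a
    b≢a = fg a
    c₀≢a : c₀ ≢ a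
    c₀≢a refl = ≢c₀ eq
    elt : ∀ c → c ≢ a → c ≢ b → ∃ λ k → k · a ≡ b × k · c ≡ c
    elt c c≢a c≢b = trans₂ (c≢a ∘ sym) (c≢b ∘ sym)
    -- The two excluded arguments receive the two values that the other arguments miss. This makes
    -- `F` injective on all of `Fin q`, hence onto, so that it cannot miss `g′ · c₀` as well.
    F′ : ∀ c → Dec (c ≡ a) → Dec (c ≡ b) → Fin q
    F′ c (yes _) _ = g · c₀
    F′ c (no _) (yes _) = b
    F′ c (no c≢a) (no c≢b) = proj₁ (elt c c≢a c≢b) · c₀
    F : Fin q → Fin q
    F c = F′ c (c ≟ a) (c ≟ b)
    F-inj : Inj F
    F-inj {c} {d} = go (c ≟ a) (c ≟ b) (d ≟ a) (d ≟ b)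
      where
      gc₀≢b : g · c₀ ≢ b
      gc₀≢b = c₀≢a ∘ act-inj g
      elt-c₀≢g : ∀ c c≢a c≢b → proj₁ (elt c c≢a c≢b) · c₀ ≢ g · c₀
      elt-c₀≢g c c≢a c≢b e with elt c c≢a c≢b
      ... | k , ka , kc = fg c (trans (sym (sharp {k} {g} (c₀≢a ∘ sym) ka e c)) kc)
      elt-c₀≢b : ∀ c c≢a c≢b → proj₁ (elt c c≢a c≢b) · c₀ ≢ b
      elt-c₀≢b c c≢a c≢b e with elt c c≢a c≢b
      ... | k , ka , kc = c₀≢a (act-inj k (trans e (sym ka)))
      go : ∀ ca cb da db → F′ c ca cb ≡ F′ d da db → c ≡ d
      go (yes refl) _ (yes refl) _ e = refl
      go (yes _) _ (no _) (yes _) e = contradiction e gc₀≢b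
      go (yes _) _ (no d≢a) (no d≢b) e = contradiction (sym e) (elt-c₀≢g d d≢a d≢b)
      go (no _) (yes _) (yes _) _ e = contradiction (sym e) gc₀≢b
      go (no _) (yes refl) (no _) (yes refl) e = refl
      go (no _) (yes _) (no d≢a) (no d≢b) e = contradiction (sym e) (elt-c₀≢b d d≢a d≢b)
      go (no c≢a) (no c≢b) (yes _) _ e = contradiction e (elt-c₀≢g c c≢a c≢b)
      go (no c≢a) (no c≢b) (no _) (yes _) e = contradiction e (elt-c₀≢b c c≢a c≢b)
      go (no c≢a) (no c≢b) (no d≢a) (no d≢b) e
        with elt c c≢a c≢b | elt d d≢a d≢b
      ... | k , ka , kc | l , la , ld with c ≟ d
      ...   | yes p = p
      ...   | no c≢d = contradiction (trans (sym ka) (sharp-id c≢d kc kd a)) b≢a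
        where
        kd = trans (sharp {k} {l} (c₀≢a ∘ sym) (trans ka (sym la)) e d) ld
    F-miss : ∀ c → F c ≢ g′ · c₀
    F-miss c = go (c ≟ a) (c ≟ b)
      where
      go : ∀ ca cb → F′ c ca cb ≢ g′ · c₀
      go (yes _) _ e = ≢c₀ e
      go (no _) (yes _) e = c₀≢a (act-inj g′ (trans (sym e) eq))
      go (no c≢a) (no c≢b) e with elt c c≢a c≢b
      ... | k , ka , kc = fg′ c (trans (sym (sharp {k} {g′} (c₀≢a ∘ sym) (trans ka eq) e c)) kc)

  -- For c outside {a, b} let k fix c and send a to b; `F` records the value of k at b. Since `F`
  -- takes the value b at both a and b, it misses some e. An element with a ↦ b ↦ e cannot fix such
  -- a c, because it would then be that k and e would be attained.
  fpf-exists : ∀ {a b} → a ≢ b → ∃ λ g → FixedPointFree g × g · a ≡ b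
  fpf-exists {a} {b} a≢b = g , g-fpf , ga
    where
    elt : ∀ c → c ≢ a → c ≢ b → ∃ λ k → k · a ≡ b × k · c ≡ c
    elt c c≢a c≢b = trans₂ (c≢a ∘ sym) (c≢b ∘ sym)
    F′ : ∀ c → Dec (c ≡ a) → Dec (c ≡ b) → Fin q
    F′ c (yes _) _ = b
    F′ c (no _) (yes _) = b
    F′ c (no c≢a) (no c≢b) = proj₁ (elt c c≢a c≢b) · b
    F : Fin q → Fin q
    F c = F′ c (c ≟ a) (c ≟ b)
    Fa : ∀ da db → F′ a da db ≡ b
    Fa (yes _) _ = refl
    Fa (no _) (yes _) = refl
    Fa (no a≢a) (no _) = contradiction refl a≢a
    Fb : ∀ da db → F′ b da db ≡ b
    Fb (yes _) _ = refl
    Fb (no _) (yes _) = refl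
    Fb (no _) (no b≢b) = contradiction refl b≢b
    missed = collision⇒miss F a≢b (trans (Fa (a ≟ a) (a ≟ b)) (sym (Fb (b ≟ a) (b ≟ b))))
    e = proj₁ missed
    b≢e : b ≢ e
    b≢e p = proj₂ missed a (trans (Fa (a ≟ a) (a ≟ b)) p)
    found = trans₂ a≢b b≢e
    g = proj₁ found
    ga = proj₁ (proj₂ found)
    gb = proj₂ (proj₂ found)
    g-fpf : FixedPointFree g
    g-fpf c gc = go (c ≟ a) (c ≟ b) (proj₂ missed c)
      where
      go : ∀ da db → F′ c da db ≢ e → _
      go (yes refl) _ _ = a≢b (trans (sym gc) ga)
      go (no _) (yes refl) _ = b≢e (trans (sym gc) gb)
      go (no c≢a) (no c≢b) ne with elt c c≢a c≢b
      ... | k , ka , kc =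
        ne (trans (sharp {k} {g} (c≢a ∘ sym) (trans ka (sym ga)) (trans kc (sym gc)) b) gb)

  conj : G → G → G
  conj k g = k ∙ g ∙ k ⁻¹

  conj-act : ∀ k g x → conj k g · k · x ≡ k · g · x
  conj-act k g x = begin
    conj k g · k · x          ≡⟨ ∙-act (k ∙ g) (k ⁻¹) (k · x) ⟩
    (k ∙ g) · k ⁻¹ · k · x    ≡⟨ cong ((k ∙ g) ·_) (⁻¹-actˡ k x) ⟩
    (k ∙ g) · x               ≡⟨ ∙-act k g x ⟩
    k · g · x                 ∎
    where open ≡-Reasoning

  conj-fpf : ∀ k {g} → FixedPointFree g → FixedPointFree (conj k g)
  conj-fpf k {g} fg x eq = fg (k ⁻¹ · x) (act-inj k (begin
    k · g · k ⁻¹ · x          ≡⟨ conj-act k g (k ⁻¹ · x) ⟨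
    conj k g · k · k ⁻¹ · x   ≡⟨ cong (conj k g ·_) (⁻¹-actʳ k x) ⟩
    conj k g · x              ≡⟨ eq ⟩
    x                         ≡⟨ ⁻¹-actʳ k x ⟨
    k · k ⁻¹ · x              ∎))
    where open ≡-Reasoning

  -- Along with `c`, the element `k` fixes the different point `x · c`.
  commutes⇒id : ∀ {k x} → FixedPointFree x → (∀ z → k · x · z ≡ x · k · z) →
    ∀ {c} → k · c ≡ c → ∀ z → k · z ≡ z
  commutes⇒id {k} {x} fx kx {c} kc =
    sharp-id (fx c ∘ sym) kc (trans (kx c) (cong (x ·_) kc))

  -- The point stabiliser acts transitively by conjugation on the
  -- fixed-point-free elements, so h y centralises x for some h fixing y·z;
  -- being fixed-point-free, h y is y.
  fpf-comm : ∀ {x y} → FixedPointFree x → FixedPointFree y → ∀ z → y · x · z ≡ x · y · z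
  fpf-comm {x} {y} fx fy z = trans (sym (k≗y (x · z))) (trans (kx z) (cong (x ·_) (k≗y z)))
    where
    b = y · z
    found = trans₂ {b} {conj y x · b} {b} {x · b} (conj-fpf y fx b ∘ sym) (fx b ∘ sym)
    h = proj₁ found
    hb = proj₁ (proj₂ found)
    k = h ∙ y
    kz : k · z ≡ b
    kz = trans (∙-act h y z) hb
    hx : ∀ w → h · conj y x · w ≡ x · h · w
    hx w = begin
      h · conj y x · w                       ≡⟨ conj-act h (conj y x) w ⟨
      conj h (conj y x) · h · w              ≡⟨ fpf-unique (conj-fpf h (conj-fpf y fx)) fx at-b (h · w) ⟩
      x · h · w                              ∎
      where
      open ≡-Reasoning
      at-b : conj h (conj y x) · b ≡ x · b
      at-b = begin
        conj h (conj y x) · b        ≡⟨ cong (conj h (conj y x) ·_) hb ⟨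
        conj h (conj y x) · h · b    ≡⟨ conj-act h (conj y x) b ⟩
        h · conj y x · b             ≡⟨ proj₂ (proj₂ found) ⟩
        x · b                        ∎
    kx : ∀ w → k · x · w ≡ x · k · w
    kx w = begin
      k · x · w                  ≡⟨ ∙-act h y (x · w) ⟩
      h · y · x · w              ≡⟨ cong (h ·_) (conj-act y x w) ⟨
      h · conj y x · y · w       ≡⟨ hx (y · w) ⟩
      x · h · y · w              ≡⟨ cong (x ·_) (∙-act h y w) ⟨
      x · k · w                  ∎
      where open ≡-Reasoning
    k-fpf : FixedPointFree k
    k-fpf c kc = fy z (trans (sym kz) (commutes⇒id {k} {x} fx kx kc z))
    k≗y : k ≗· y
    k≗y = fpf-unique k-fpf fy kz

  -- The field carried by a sharply 2-transitive group

  Translation : G → Set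
  Translation g = FixedPointFree g ⊎ (g ≗· ι)

  translation-unique : ∀ {g g′} → Translation g → Translation g′ →
    ∀ {a} → g · a ≡ g′ · a → g ≗· g′
  translation-unique (inj₁ fg) (inj₁ fg′) eq = fpf-unique fg fg′ eq
  translation-unique (inj₁ fg) (inj₂ g′≗) {a} eq =
    contradiction (trans eq (trans (g′≗ a) (ι-act a))) (fg a)
  translation-unique (inj₂ g≗) (inj₁ fg′) {a} eq =
    contradiction (trans (sym eq) (trans (g≗ a) (ι-act a))) (fg′ a)
  translation-unique (inj₂ g≗) (inj₂ g′≗) eq x = trans (g≗ x) (sym (g′≗ x))

  id-at : ∀ {g} → (g ≗· ι) → ∀ x → g · x ≡ x
  id-at g≗ x = trans (g≗ x) (ι-act x)

  translation-comm : ∀ {x y} → Translation x → Translation y → ∀ z → x · y · z ≡ y · x · z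
  translation-comm (inj₁ fx) (inj₁ fy) z = fpf-comm fy fx z
  translation-comm {x} {y} (inj₂ x≗) _ z =
    trans (id-at x≗ (y · z)) (cong (y ·_) (sym (id-at x≗ z)))
  translation-comm {x} {y} (inj₁ _) (inj₂ y≗) z =
    trans (cong (x ·_) (id-at y≗ z)) (sym (id-at y≗ (x · z)))

  -- The product commutes with its fixed-point-free factor `x`, so a single fixed point already
  -- makes it the identity.
  translation-∙ : ∀ {x y} → Translation x → Translation y → Translation (x ∙ y)
  translation-∙ {x} {y} (inj₂ x≗) (inj₂ y≗) =
    inj₂ λ z → trans (∙-act x y z) (trans (id-at x≗ (y · z)) (y≗ z))
  translation-∙ {x} {y} (inj₂ x≗) (inj₁ fy) =
    inj₁ λ z eq → fy z (trans (sym (trans (∙-act x y z) (id-at x≗ (y · z)))) eq)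
  translation-∙ {x} {y} (inj₁ fx) ty with any? (λ c → (x ∙ y) · c ≟ c)
  ... | no none = inj₁ λ c eq → none (c , eq)
  ... | yes (c , fixed) = inj₂ λ z →
    trans (commutes⇒id {x ∙ y} {x} fx xy-x fixed z) (sym (ι-act z))
    where
    xy-x : ∀ z → (x ∙ y) · x · z ≡ x · (x ∙ y) · z
    xy-x z = trans (∙-act x y (x · z)) (cong (x ·_)
      (trans (translation-comm ty (inj₁ fx) z) (sym (∙-act x y z))))

  translation-conj : ∀ k {g} → Translation g → Translation (conj k g)
  translation-conj k (inj₁ fg) = inj₁ (conj-fpf k fg)
  translation-conj k {g} (inj₂ g≗) = inj₂ λ x → begin
    conj k g · x            ≡⟨ cong (conj k g ·_) (⁻¹-actʳ k x) ⟨
    conj k g · k · k ⁻¹ · x ≡⟨ conj-act k g (k ⁻¹ · x) ⟩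
    k · g · k ⁻¹ · x        ≡⟨ cong (k ·_) (id-at g≗ (k ⁻¹ · x)) ⟩
    k · k ⁻¹ · x            ≡⟨ ⁻¹-actʳ k x ⟩
    x                       ≡⟨ ι-act x ⟨
    ι · x                   ∎
    where open ≡-Reasoning

  translation-to : ∀ u → ∃ λ g → Translation g × g · 𝟘 ≡ u
  translation-to u with 𝟘 ≟ u
  ... | yes refl = ι , inj₂ (λ _ → refl) , ι-act 𝟘
  ... | no 0≢u with fpf-exists 0≢u
  ...   | g , fg , g0 = g , inj₁ fg , g0

  τ : Fin q → G
  τ u = proj₁ (translation-to u)

  τ-translation : ∀ u → Translation (τ u)
  τ-translation u = proj₁ (proj₂ (translation-to u))

  τ-𝟘 : ∀ u → τ u · 𝟘 ≡ u
  τ-𝟘 u = proj₂ (proj₂ (translation-to u))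

  scaling-to : ∀ m → m ≢ 𝟘 → ∃ λ g → g · 𝟘 ≡ 𝟘 × g · 𝟙 ≡ m
  scaling-to m m≢0 = trans₂ 𝟘≢𝟙 (m≢0 ∘ sym)

  infixl 6 _⊕_
  infixl 7 _⊗_
  _⊕_ _⊗_ : Fin q → Fin q → Fin q
  u ⊕ v = τ u · v

  mul : ∀ m → Dec (m ≡ 𝟘) → Fin q → Fin q
  mul m (yes _) x = 𝟘
  mul m (no m≢0) x = proj₁ (scaling-to m m≢0) · x
  m ⊗ x = mul m (m ≟ 𝟘) x

  𝟘⊗ : ∀ x → 𝟘 ⊗ x ≡ 𝟘
  𝟘⊗ x with 𝟘 ≟ 𝟘
  ... | yes _ = refl
  ... | no ≢ = contradiction refl ≢

  -- By sharpness at `𝟘` and `𝟙`, any stabiliser element is the multiplication by its value at `𝟙`,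
  -- whichever element `scaling-to` happened to choose. The multiplicative laws thereby become laws
  -- of composition.
  stabilizer-⊗ : ∀ g → g · 𝟘 ≡ 𝟘 → ∀ x → g · x ≡ (g · 𝟙) ⊗ x
  stabilizer-⊗ g g0 x with (g · 𝟙) ≟ 𝟘
  ... | yes g1 = contradiction (act-inj g (trans g0 (sym g1))) 𝟘≢𝟙
  ... | no g1≢0 with scaling-to (g · 𝟙) g1≢0
  ...   | h , h0 , h1 = sharp {g} {h} 𝟘≢𝟙 (trans g0 (sym h0)) (sym h1) x

  -- A view of the scalars: matching on it replaces `m` by `g · 𝟙`, the form to which `stabilizer-⊗`
  -- applies.
  data Scaling (m : Fin q) : Set where
    zeroᵐ : m ≡ 𝟘 → Scaling m
    scale : ∀ g → g · 𝟘 ≡ 𝟘 → m ≡ g · 𝟙 → Scaling m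

  scaling : ∀ m → Scaling m
  scaling m with m ≟ 𝟘
  ... | yes m≡0 = zeroᵐ m≡0
  ... | no m≢0 with scaling-to m m≢0
  ...   | g , g0 , g1 = scale g g0 (sym g1)

  ⊗𝟘 : ∀ x → x ⊗ 𝟘 ≡ 𝟘
  ⊗𝟘 x with scaling x
  ... | zeroᵐ refl = 𝟘⊗ 𝟘
  ... | scale g g0 refl = trans (sym (stabilizer-⊗ g g0 𝟘)) g0

  ⊗-comm : ∀ x y → x ⊗ y ≡ y ⊗ x
  ⊗-comm x y with scaling x | scaling y
  ... | zeroᵐ refl | _ = trans (𝟘⊗ y) (sym (⊗𝟘 y))
  ... | scale _ _ _ | zeroᵐ refl = trans (⊗𝟘 x) (sym (𝟘⊗ x))
  ... | scale g g0 refl | scale h h0 refl = begin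
    (g · 𝟙) ⊗ (h · 𝟙) ≡⟨ stabilizer-⊗ g g0 (h · 𝟙) ⟨
    g · h · 𝟙         ≡⟨ stabilizer-comm g h g0 h0 𝟙 ⟩
    h · g · 𝟙         ≡⟨ stabilizer-⊗ h h0 (g · 𝟙) ⟩
    (h · 𝟙) ⊗ (g · 𝟙) ∎
    where open ≡-Reasoning

  ⊗-assoc : ∀ x y z → (x ⊗ y) ⊗ z ≡ x ⊗ (y ⊗ z)
  ⊗-assoc x y z with scaling x | scaling y
  ... | zeroᵐ refl | _ = trans (cong (_⊗ z) (𝟘⊗ y)) (trans (𝟘⊗ z) (sym (𝟘⊗ (y ⊗ z))))
  ... | scale _ _ _ | zeroᵐ refl =
    trans (cong (_⊗ z) (⊗𝟘 x)) (trans (𝟘⊗ z) (sym (trans (cong (x ⊗_) (𝟘⊗ z)) (⊗𝟘 x))))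
  ... | scale g g0 refl | scale h h0 refl = begin
    ((g · 𝟙) ⊗ (h · 𝟙)) ⊗ z  ≡⟨ cong (_⊗ z) (stabilizer-⊗ g g0 (h · 𝟙)) ⟨
    (g · h · 𝟙) ⊗ z          ≡⟨ cong (_⊗ z) (∙-act g h 𝟙) ⟨
    ((g ∙ h) · 𝟙) ⊗ z        ≡⟨ stabilizer-⊗ (g ∙ h) (trans (∙-act g h 𝟘) (trans (cong (g ·_) h0) g0)) z ⟨
    (g ∙ h) · z              ≡⟨ ∙-act g h z ⟩
    g · h · z                ≡⟨ cong (g ·_) (stabilizer-⊗ h h0 z) ⟩
    g · ((h · 𝟙) ⊗ z)        ≡⟨ stabilizer-⊗ g g0 ((h · 𝟙) ⊗ z) ⟩
    (g · 𝟙) ⊗ ((h · 𝟙) ⊗ z)  ∎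
    where open ≡-Reasoning

  ⊗-identityˡ : ∀ x → 𝟙 ⊗ x ≡ x
  ⊗-identityˡ x = begin
    𝟙 ⊗ x         ≡⟨ cong (_⊗ x) (ι-act 𝟙) ⟨
    (ι · 𝟙) ⊗ x   ≡⟨ stabilizer-⊗ ι (ι-act 𝟘) x ⟨
    ι · x         ≡⟨ ι-act x ⟩
    x             ∎
    where open ≡-Reasoning

  ⊗-inverse : ∀ x → x ≢ 𝟘 → ∃ λ y → x ⊗ y ≡ 𝟙
  ⊗-inverse x x≢0 with scaling x
  ... | zeroᵐ x≡0 = contradiction x≡0 x≢0
  ... | scale g g0 refl = g ⁻¹ · 𝟙 , trans (sym (stabilizer-⊗ g g0 _)) (⁻¹-actʳ g 𝟙)

  ⊕-comm : ∀ u v → u ⊕ v ≡ v ⊕ u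
  ⊕-comm u v = begin
    τ u · v         ≡⟨ cong (τ u ·_) (τ-𝟘 v) ⟨
    τ u · τ v · 𝟘   ≡⟨ translation-comm (τ-translation u) (τ-translation v) 𝟘 ⟩
    τ v · τ u · 𝟘   ≡⟨ cong (τ v ·_) (τ-𝟘 u) ⟩
    τ v · u         ∎
    where open ≡-Reasoning

  -- The composite of two translations is a translation, and translations are determined by the
  -- image of `𝟘`.
  ⊕-assoc : ∀ u v w → (u ⊕ v) ⊕ w ≡ u ⊕ (v ⊕ w)
  ⊕-assoc u v w = trans
    (translation-unique (τ-translation (u ⊕ v))
      (translation-∙ (τ-translation u) (τ-translation v)) at-𝟘 w)
    (∙-act (τ u) (τ v) w)
    where
    at-𝟘 : τ (u ⊕ v) · 𝟘 ≡ (τ u ∙ τ v) · 𝟘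
    at-𝟘 = trans (τ-𝟘 (u ⊕ v)) (sym (trans (∙-act (τ u) (τ v) 𝟘) (cong (τ u ·_) (τ-𝟘 v))))

  ⊖ : Fin q → Fin q
  ⊖ u = τ u ⁻¹ · 𝟘

  ⊕-inverseʳ : ∀ u → u ⊕ ⊖ u ≡ 𝟘
  ⊕-inverseʳ u = ⁻¹-actʳ (τ u) 𝟘

  -- Conjugating `τ u` by a stabiliser element `g` gives a translation that takes `𝟘` to `g · u`, so
  -- it must act as `τ (g · u)`.
  distribˡ : ∀ m u v → m ⊗ (u ⊕ v) ≡ m ⊗ u ⊕ m ⊗ v
  distribˡ m u v with scaling m
  ... | zeroᵐ refl = trans (𝟘⊗ (u ⊕ v)) (sym (trans (cong₂ _⊕_ (𝟘⊗ u) (𝟘⊗ v)) (τ-𝟘 𝟘)))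
  ... | scale g g0 refl = begin
    (g · 𝟙) ⊗ (u ⊕ v)              ≡⟨ stabilizer-⊗ g g0 (u ⊕ v) ⟨
    g · τ u · v                    ≡⟨ conj-act g (τ u) v ⟨
    conj g (τ u) · g · v           ≡⟨ translation-unique (translation-conj g (τ-translation u))
                                        (τ-translation (g · u)) at-𝟘 (g · v) ⟩
    (g · u) ⊕ (g · v)              ≡⟨ cong₂ _⊕_ (stabilizer-⊗ g g0 u) (stabilizer-⊗ g g0 v) ⟩
    (g · 𝟙) ⊗ u ⊕ (g · 𝟙) ⊗ v      ∎
    where
    open ≡-Reasoning
    at-𝟘 : conj g (τ u) · 𝟘 ≡ τ (g · u) · 𝟘
    at-𝟘 = begin
      conj g (τ u) · 𝟘        ≡⟨ cong (conj g (τ u) ·_) g0 ⟨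
      conj g (τ u) · g · 𝟘    ≡⟨ conj-act g (τ u) 𝟘 ⟩
      g · τ u · 𝟘             ≡⟨ cong (g ·_) (τ-𝟘 u) ⟩
      g · u                   ≡⟨ τ-𝟘 (g · u) ⟨
      τ (g · u) · 𝟘           ∎

  ⊕-⊗-isCommutativeRing : IsCommutativeRing _≡_ _⊕_ _⊗_ ⊖ 𝟘 𝟙
  ⊕-⊗-isCommutativeRing = record
    { isRing = record
      { +-isAbelianGroup = record
        { isGroup = record
          { isMonoid = record
            { isSemigroup = record
              { isMagma = record { isEquivalence = isEquivalence ; ∙-cong = cong₂ _⊕_ }
              ; assoc = ⊕-assoc }
            ; identity = (λ u → trans (⊕-comm 𝟘 u) (τ-𝟘 u)) , τ-𝟘 }
          ; inverse = (λ u → trans (⊕-comm (⊖ u) u) (⊕-inverseʳ u)) , ⊕-inverseʳ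
          ; ⁻¹-cong = cong ⊖ }
        ; comm = ⊕-comm }
      ; *-cong = cong₂ _⊗_
      ; *-assoc = ⊗-assoc
      ; *-identity = ⊗-identityˡ , λ x → trans (⊗-comm x 𝟙) (⊗-identityˡ x)
      ; distrib = distribˡ , λ m u v → trans (⊗-comm (u ⊕ v) m)
          (trans (distribˡ m u v) (cong₂ _⊕_ (⊗-comm m u) (⊗-comm m v))) }
    ; *-comm = ⊗-comm }

  field-on : FieldOn q
  field-on = record
    { _+_ = _⊕_ ; _*_ = _⊗_ ; -_ = ⊖ ; 0# = 𝟘 ; 1# = 𝟙
    ; isCommutativeRing = ⊕-⊗-isCommutativeRing
    ; 0≢1 = 𝟘≢𝟙
    ; inverse = ⊗-inverse }

-- The order of a finite field

ringOf : ∀ {q} → FieldOn q → CommutativeRing _ _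
ringOf F = record { isCommutativeRing = FieldOn.isCommutativeRing F }

module Characteristic {q : ℕ} (F : FieldOn q) where
  open CommutativeRing (ringOf F)
    using (_+_; _*_; 0#; 1#; semiring; +-group; +-identityʳ; *-assoc; *-comm; *-identityˡ; zeroʳ)
  open Algebra.Properties.Semiring.Mult semiring
    renaming (_×_ to infixr 8 _⋆_)
  open import Algebra.Properties.Group +-group
    using () renaming (∙-cancelˡ to +-cancelˡ)
  open ≡-Reasoning

  -- The product `product (p ∷ ps) ⋆ 1#` splits as a product in the field, so a nonzero first factor
  -- can be cancelled.
  product-vanishes⇒factor : ∀ ps → All Prime ps → product ps ⋆ 1# ≡ 0# →
    ∃ λ p → Prime p × p ⋆ 1# ≡ 0#
  product-vanishes⇒factor [] [] eq = contradiction (trans (sym eq) (+-identityʳ 1#)) (FieldOn.0≢1 F)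
  product-vanishes⇒factor (p ∷ ps) (pr ∷ prs) eq with (p ⋆ 1#) ≟ 0#
  ... | yes p0 = p , pr , p0
  ... | no p≢0 with FieldOn.inverse F (p ⋆ 1#) p≢0
  ...   | y , py = product-vanishes⇒factor ps prs (begin
    m                        ≡⟨ *-identityˡ m ⟨
    1# * m                   ≡⟨ cong (_* m) (trans (sym py) (*-comm _ y)) ⟩
    (y * (p ⋆ 1#)) * m       ≡⟨ *-assoc y (p ⋆ 1#) m ⟩
    y * ((p ⋆ 1#) * m)       ≡⟨ cong (y *_) (×1-homo-* p (product ps)) ⟨
    y * (product (p ∷ ps) ⋆ 1#) ≡⟨ cong (y *_) eq ⟩
    y * 0#                   ≡⟨ zeroʳ y ⟩
    0#                       ∎)
    where m = product ps ⋆ 1#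

  -- Two of the q + 1 multiples of 1 by 0, ..., q coincide. Their difference gives a positive
  -- integer that annihilates 1, and one of its prime factors does so too.
  characteristic : ∃ λ p → Prime p × p ⋆ 1# ≡ 0#
  characteristic with pigeonhole (ℕₚ.n<1+n q) (λ (i : Fin (suc q)) → toℕ i ⋆ 1#)
  ... | i , j , i<j , eq =
    product-vanishes⇒factor factors factorsPrime (trans (cong (_⋆ 1#) (sym isFactorisation)) m0)
    where
    m = toℕ j ℕ.∸ toℕ i
    instance
      m≢0 : NonZero m
      m≢0 = ℕ.>-nonZero (ℕₚ.m<n⇒0<n∸m i<j)
    m0 : m ⋆ 1# ≡ 0#
    m0 = +-cancelˡ (toℕ i ⋆ 1#) _ _ (begin
      toℕ i ⋆ 1# + m ⋆ 1#      ≡⟨ ×-homo-+ 1# (toℕ i) m ⟨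
      (toℕ i ℕ.+ m) ⋆ 1#       ≡⟨ cong (_⋆ 1#) (ℕₚ.m+[n∸m]≡n (ℕₚ.<⇒≤ i<j)) ⟩
      toℕ j ⋆ 1#               ≡⟨ eq ⟨
      toℕ i ⋆ 1#               ≡⟨ +-identityʳ _ ⟨
      toℕ i ⋆ 1# + 0#          ∎)
    open PrimeFactorisation (factorise m)

module CharacteristicPrime {q : ℕ} (F : FieldOn q) (p : ℕ) (p-prime : Prime p)
  (p⋆1 : Algebra.Properties.Semiring.Mult._×_ (CommutativeRing.semiring (ringOf F)) p (FieldOn.1# F) ≡ FieldOn.0# F)
  where
  open CommutativeRing (ringOf F)
    using (_+_; _*_; -_; 0#; 1#; semiring; +-group; +-assoc; +-identityˡ; +-identityʳ;
           *-identityʳ; zeroʳ; -‿inverseˡ; -‿inverseʳ; +-commutativeSemigroup)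
  open Algebra.Properties.Semiring.Mult semiring
    renaming (_×_ to infixr 8 _⋆_)
  open import Algebra.Properties.Group +-group
    using () renaming (∙-cancelˡ to +-cancelˡ; ∙-cancelʳ to +-cancelʳ)
  open ≡-Reasoning

  instance
    p≢0 : NonZero p
    p≢0 = prime⇒nonZero p-prime

  p⋆ : ∀ x → p ⋆ x ≡ 0#
  p⋆ x = begin
    p ⋆ x             ≡⟨ cong (p ⋆_) (*-identityʳ x) ⟨
    p ⋆ (x * 1#)      ≡⟨ ×-comm-* p x 1# ⟨
    x * (p ⋆ 1#)      ≡⟨ cong (x *_) p⋆1 ⟩
    x * 0#            ≡⟨ zeroʳ x ⟩
    0#                ∎

  multiple⋆ : ∀ n x → (n ℕ.* p) ⋆ x ≡ 0#
  multiple⋆ n x = begin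
    (n ℕ.* p) ⋆ x   ≡⟨ cong (_⋆ x) (ℕₚ.*-comm n p) ⟩
    (p ℕ.* n) ⋆ x   ≡⟨ ×-assocˡ x p n ⟨
    p ⋆ n ⋆ x       ≡⟨ p⋆ (n ⋆ x) ⟩
    0#              ∎

  %⋆ : ∀ n x → n ⋆ x ≡ (n ℕ.% p) ⋆ x
  %⋆ n x = begin
    n ⋆ x                                     ≡⟨ cong (_⋆ x) (ℕ.m≡m%n+[m/n]*n n p) ⟩
    (n ℕ.% p ℕ.+ n ℕ./ p ℕ.* p) ⋆ x           ≡⟨ ×-homo-+ x (n ℕ.% p) _ ⟩
    (n ℕ.% p) ⋆ x + (n ℕ./ p ℕ.* p) ⋆ x       ≡⟨ cong ((n ℕ.% p) ⋆ x +_) (multiple⋆ (n ℕ./ p) x) ⟩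
    (n ℕ.% p) ⋆ x + 0#                        ≡⟨ +-identityʳ _ ⟩
    (n ℕ.% p) ⋆ x                             ∎

  -- The enumeration by `Fin (p ^ k)` puts the order into the type. Negatives need no field of their
  -- own: -x is the multiple of x by p - 1.
  record Subgroup (k : ℕ) : Set where
    field
      elt       : Fin (p ^ k) → Fin q
      elt-inj   : Inj elt
    _∈S : Fin q → Set
    x ∈S = ∃ λ i → elt i ≡ x
    field
      0∈        : 0# ∈S
      +-closed  : ∀ {x y} → x ∈S → y ∈S → (x + y) ∈S

    ⋆-closed : ∀ n {x} → x ∈S → (n ⋆ x) ∈S
    ⋆-closed zero x∈ = 0∈
    ⋆-closed (suc n) x∈ = +-closed x∈ (⋆-closed n x∈)

    neg-closed : ∀ {x} → x ∈S → (- x) ∈S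
    neg-closed {x} x∈ = subst _∈S eq (⋆-closed (ℕ.pred p) x∈)
      where
      eq : ℕ.pred p ⋆ x ≡ - x
      eq = +-cancelˡ x _ _ (begin
        suc (ℕ.pred p) ⋆ x   ≡⟨ cong (_⋆ x) (ℕₚ.suc-pred p) ⟩
        p ⋆ x                ≡⟨ p⋆ x ⟩
        0#                   ≡⟨ -‿inverseʳ x ⟨
        x + - x              ∎)

    -- Bézout for m and p recovers e from m ⋆ e, since p ⋆ e = 0.
    multiple∈⇒∈ : ∀ {m e} .{{_ : NonZero m}} → m < p → (m ⋆ e) ∈S → e ∈S
    multiple∈⇒∈ {m} {e} m<p me∈ with coprime-Bézout (prime⇒coprime p-prime m<p)
    ... | Bézout.+- x y eq = subst _∈S e≡ (neg-closed (⋆-closed y me∈))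
      where
      e≡ : - (y ⋆ m ⋆ e) ≡ e
      e≡ = +-cancelʳ (y ⋆ m ⋆ e) _ _ (begin
        - (y ⋆ m ⋆ e) + y ⋆ m ⋆ e   ≡⟨ -‿inverseˡ _ ⟩
        0#                          ≡⟨ multiple⋆ x e ⟨
        (x ℕ.* p) ⋆ e               ≡⟨ cong (_⋆ e) eq ⟨
        (1 ℕ.+ y ℕ.* m) ⋆ e         ≡⟨⟩
        e + (y ℕ.* m) ⋆ e           ≡⟨ cong (e +_) (×-assocˡ e y m) ⟨
        e + y ⋆ m ⋆ e               ∎)
    ... | Bézout.-+ x y eq = subst _∈S e≡ (⋆-closed y me∈)
      where
      e≡ : y ⋆ m ⋆ e ≡ e
      e≡ = begin
        y ⋆ m ⋆ e                ≡⟨ ×-assocˡ e y m ⟩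
        (y ℕ.* m) ⋆ e            ≡⟨ cong (_⋆ e) eq ⟨
        e + (x ℕ.* p) ⋆ e        ≡⟨ cong (e +_) (multiple⋆ x e) ⟩
        e + 0#                   ≡⟨ +-identityʳ e ⟩
        e                        ∎

  trivial : Subgroup 0
  trivial = record
    { elt = λ _ → 0#
    ; elt-inj = λ { {zero} {zero} _ → refl }
    ; 0∈ = zero , refl
    ; +-closed = λ { (_ , refl) (_ , refl) → zero , sym (+-identityˡ 0#) } }

  module Extend {k : ℕ} (S : Subgroup k) (e : Fin q) (e∉S : ¬ Subgroup._∈S S e) where
    open Subgroup S

    pair : Fin p → Fin (p ^ k) → Fin q
    pair c i = toℕ c ⋆ e + elt i

    -- Subtracting the two sides puts (b - a) `⋆ e` in the subgroup, with 0 < b - a < p, and then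
    -- `e` itself lies there.
    lead-unique : ∀ {a b} → a < b → b < p → ∀ i j → a ⋆ e + elt i ≢ b ⋆ e + elt j
    lead-unique {a} {b} a<b b<p i j eq =
      e∉S (multiple∈⇒∈ m<p (subst _∈S me≡ (+-closed (i , refl) (neg-closed (j , refl)))))
      where
      m = b ℕ.∸ a
      m<p : m < p
      m<p = ℕₚ.≤-<-trans (ℕₚ.m∸n≤m b a) b<p
      instance
        m≢0 : NonZero m
        m≢0 = ℕ.>-nonZero (ℕₚ.m<n⇒0<n∸m a<b)
      s≡ : elt i ≡ m ⋆ e + elt j
      s≡ = +-cancelˡ (a ⋆ e) _ _ (begin
        a ⋆ e + elt i              ≡⟨ eq ⟩
        b ⋆ e + elt j              ≡⟨ cong (λ n → n ⋆ e + elt j) (ℕₚ.m+[n∸m]≡n (ℕₚ.<⇒≤ a<b)) ⟨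
        (a ℕ.+ m) ⋆ e + elt j      ≡⟨ cong (_+ elt j) (×-homo-+ e a m) ⟩
        (a ⋆ e + m ⋆ e) + elt j    ≡⟨ +-assoc (a ⋆ e) (m ⋆ e) (elt j) ⟩
        a ⋆ e + (m ⋆ e + elt j)    ∎)
      me≡ : elt i + - elt j ≡ m ⋆ e
      me≡ = begin
        elt i + - elt j             ≡⟨ cong (_+ - elt j) s≡ ⟩
        (m ⋆ e + elt j) + - elt j   ≡⟨ +-assoc (m ⋆ e) (elt j) (- elt j) ⟩
        m ⋆ e + (elt j + - elt j)   ≡⟨ cong (m ⋆ e +_) (-‿inverseʳ (elt j)) ⟩
        m ⋆ e + 0#                  ≡⟨ +-identityʳ _ ⟩
        m ⋆ e                       ∎

    pair-inj : ∀ {c d i j} → pair c i ≡ pair d j → c ≡ d × i ≡ j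
    pair-inj {c} {d} {i} {j} eq with ℕₚ.<-cmp (toℕ c) (toℕ d)
    ... | tri< c<d _ _ = contradiction eq (lead-unique c<d (toℕ<n d) i j)
    ... | tri> _ _ d<c = contradiction (sym eq) (lead-unique d<c (toℕ<n c) j i)
    ... | tri≈ _ c≡d _ with toℕ-injective c≡d
    ...   | refl = refl , elt-inj (+-cancelˡ (toℕ c ⋆ e) _ _ eq)

    elt′ : Fin (p ^ suc k) → Fin q
    elt′ x = pair (proj₁ (remQuot {p} (p ^ k) x)) (proj₂ (remQuot {p} (p ^ k) x))

    elt′-inj : Inj elt′
    elt′-inj {x} {y} eq with pair-inj eq
    ... | eq₁ , eq₂ = begin
      x                                           ≡⟨ combine-remQuot {p} (p ^ k) x ⟨
      combine (proj₁ (remQuot {p} (p ^ k) x)) (proj₂ (remQuot {p} (p ^ k) x)) ≡⟨ cong₂ combine eq₁ eq₂ ⟩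
      combine (proj₁ (remQuot {p} (p ^ k) y)) (proj₂ (remQuot {p} (p ^ k) y)) ≡⟨ combine-remQuot {p} (p ^ k) y ⟩
      y                                           ∎

    -- The coefficient of `e` may be any natural number and is reduced mod `p`, so closure under
    -- addition has no carries to distinguish.
    ∈′ : ∀ n {s} → s ∈S → ∃ λ x → elt′ x ≡ n ⋆ e + s
    ∈′ n {s} (i , refl) = combine c i , (begin
      elt′ (combine c i)          ≡⟨ cong (λ (c , i) → pair c i) (remQuot-combine c i) ⟩
      toℕ c ⋆ e + elt i           ≡⟨ cong (λ m → m ⋆ e + elt i) (toℕ-fromℕ< (ℕ.m%n<n n p)) ⟩
      (n ℕ.% p) ⋆ e + elt i       ≡⟨ cong (_+ elt i) (%⋆ n e) ⟨
      n ⋆ e + elt i               ∎)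
      where c = fromℕ< (ℕ.m%n<n n p)

    extended : Subgroup (suc k)
    extended = record
      { elt = elt′
      ; elt-inj = elt′-inj
      ; 0∈ = subst (λ y → ∃ λ x → elt′ x ≡ y) (+-identityˡ 0#) (∈′ 0 0∈)
      ; +-closed = λ { (x , refl) (y , refl) → closed (remQuot {p} (p ^ k) x) (remQuot {p} (p ^ k) y) } }
      where
      closed : ∀ ((c , i) : Fin p × Fin (p ^ k)) ((d , j) : Fin p × Fin (p ^ k)) → ∃ λ x → elt′ x ≡ pair c i + pair d j
      closed (c , i) (d , j) = subst (λ y → ∃ λ x → elt′ x ≡ y) eq
        (∈′ (toℕ c ℕ.+ toℕ d) (+-closed (i , refl) (j , refl)))
        where
        open import Algebra.Properties.CommutativeSemigroup
          +-commutativeSemigroup using (interchange)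
        eq : (toℕ c ℕ.+ toℕ d) ⋆ e + (elt i + elt j) ≡ pair c i + pair d j
        eq = trans (cong (_+ (elt i + elt j)) (×-homo-+ e (toℕ c) (toℕ d))) (interchange _ _ _ _)

  k<p^k : ∀ k → k < p ^ k
  k<p^k zero = ℕ.s≤s ℕ.z≤n
  k<p^k (suc k) = ℕₚ.≤-trans (ℕ.s≤s (k<p^k k))
    (subst (p ^ k <_) (ℕₚ.*-comm (p ^ k) p) (ℕₚ.m<m*n (p ^ k) p (ℕ.nonTrivial⇒n>1 p)))
    where
    instance
      _ = prime⇒nonTrivial p-prime
      _ = ℕₚ.m^n≢0 p k

  -- As long as the subgroup misses some element, adjoining it multiplies the order by `p`. The
  -- process stops before the fuel runs out: with none left, q ≤ k < p^k ≤ q.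
  grow : ∀ fuel k → q ≤ fuel ℕ.+ k → Subgroup k → ∃ λ k → q ≡ p ^ k
  grow fuel k bound S with all? (λ x → any? (λ i → Subgroup.elt S i ≟ x))
  ... | yes onto = k , ℕₚ.≤-antisym (injective⇒≤ section-inj) (injective⇒≤ (Subgroup.elt-inj S))
    where
    section-inj : Inj (proj₁ ∘ onto)
    section-inj {x} {y} eq =
      trans (sym (proj₂ (onto x))) (trans (cong (Subgroup.elt S) eq) (proj₂ (onto y)))
  ... | no ¬onto with ¬∀⟶∃¬ q _ (λ x → any? (λ i → Subgroup.elt S i ≟ x)) ¬onto
  grow zero k bound S | no _ | _ =
    contradiction (ℕₚ.≤-trans (k<p^k k) (ℕₚ.≤-trans (injective⇒≤ (Subgroup.elt-inj S)) bound)) ℕₚ.1+n≰n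
  grow (suc fuel) k bound S | no _ | e , e∉ =
    grow fuel (suc k) (subst (q ≤_) (sym (ℕₚ.+-suc fuel k)) bound) (Extend.extended S e e∉)

field-order : ∀ {q} → FieldOn q → IsPrimePower q
field-order {q} F with Characteristic.characteristic F
... | p , p-prime , p⋆1 with grow q 0 (ℕₚ.m≤m+n q 0) trivial
  where open CharacteristicPrime F p p-prime p⋆1
... | k , eq = p , k , p-prime , eq

-- Automorphisms of Hamming graphs

vec-ext : ∀ {A : Set} {n} {v w : Vec A n} → (∀ i → lookup v i ≡ lookup w i) → v ≡ w
vec-ext {v = v} {w} eq =
  trans (sym (tabulate∘lookup v)) (trans (tabulate-cong eq) (tabulate∘lookup w))

-- This is the connectedness of the Hamming graph: any vertex is reached by overwriting the
-- coordinates one at a time. Overwriting may leave a value unchanged, so no case distinction is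
-- forced here.
vertex-induction : ∀ {A : Set} {n} (P : Vec A n → Set) {v : Vec A n} → P v →
  (∀ u k c → P u → P (u [ k ]≔ c)) → ∀ w → P w
vertex-induction P {[]} Pv step [] = Pv
vertex-induction P {x ∷ v} Pv step (y ∷ w) =
  vertex-induction (P ∘ (y ∷_)) (step (x ∷ v) zero y Pv) (λ u k c → step (y ∷ u) (suc k) c) w

another : ∀ {q} → 1 < q → (c : Fin q) → ∃ λ c′ → c ≢ c′
another (ℕ.s≤s (ℕ.s≤s _)) zero = suc zero , λ ()
another (ℕ.s≤s (ℕ.s≤s _)) (suc c) = zero , λ ()

-- Unlike `Adj`, a record does not unfold into statements about `lookup`, so the endpoints can be
-- inferred; the direction of the edge becomes an index.
record AdjAt {d q : ℕ} (i : Fin d) (v w : Vert d q) : Set where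
  constructor adjAt
  field
    differ : lookup v i ≢ lookup w i
    agree  : ∀ j → j ≢ i → lookup v j ≡ lookup w j

open AdjAt

⟪_⟫ : ∀ {d q i} {v w : Vert d q} → AdjAt i v w → Adj v w
⟪_⟫ {i = i} (adjAt differ agree) = i , differ , agree

at : ∀ {d q} {v w : Vert d q} (a : Adj v w) → AdjAt (proj₁ a) v w
at (i , differ , agree) = adjAt differ agree

module _ {d q : ℕ} where

  AdjAt-sym : ∀ {i} {v w : Vert d q} → AdjAt i v w → AdjAt i w v
  AdjAt-sym (adjAt ne eq) = adjAt (ne ∘ sym) λ j j≢i → sym (eq j j≢i)

  Adj-sym : ∀ {v w : Vert d q} → Adj v w → Adj w v
  Adj-sym {v} {w} a = ⟪ AdjAt-sym (at {v = v} {w} a) ⟫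

  update-AdjAt : ∀ (v : Vert d q) i {c} → lookup v i ≢ c → AdjAt i v (v [ i ]≔ c)
  update-AdjAt v i {c} ne =
    adjAt (λ eq → ne (trans eq (lookup∘update i v c))) λ j j≢i → sym (lookup∘update′ j≢i v c)

  differ⇒index : ∀ {i k} {v w : Vert d q} → AdjAt i v w → lookup v k ≢ lookup w k → k ≡ i
  differ⇒index {i} {k} (adjAt _ eq) ne with k ≟ i
  ... | yes p = p
  ... | no k≢i = contradiction (eq k k≢i) ne

  AdjAt-unique : ∀ {i j} {v w : Vert d q} → AdjAt i v w → AdjAt j v w → i ≡ j
  AdjAt-unique a b = differ⇒index b (differ a)

  differ-twice : ∀ {i j} {v w : Vert d q} →
    lookup v i ≢ lookup w i → lookup v j ≢ lookup w j → Adj v w → i ≡ j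
  differ-twice {v = v} {w} ni nj a =
    trans (differ⇒index (at {v = v} {w} a) ni) (sym (differ⇒index (at {v = v} {w} a) nj))

  collinear-Adj : ∀ {i} {x y z : Vert d q} → AdjAt i x y → AdjAt i x z → y ≢ z → AdjAt i y z
  collinear-Adj {i} {x} {y} {z} (adjAt _ xy) (adjAt _ xz) y≢z = adjAt ne off
    where
    off : ∀ j → j ≢ i → lookup y j ≡ lookup z j
    off j j≢i = trans (sym (xy j j≢i)) (xz j j≢i)
    ne : lookup y i ≢ lookup z i
    ne eq = y≢z (vec-ext go)
      where
      go : ∀ j → lookup y j ≡ lookup z j
      go j with j ≟ i
      ... | yes refl = eq
      ... | no j≢i = off j j≢i

  -- Steps from `x` in two different directions lead to vertices that differ in both coordinates,
  -- which are not adjacent. Triangles therefore see lines.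
  triangle : ∀ {i j} {x y z : Vert d q} → AdjAt i x y → AdjAt j x z → Adj y z → i ≡ j
  triangle {i} {j} {x} {y} {z} (adjAt xy xy′) (adjAt xz xz′) yz with i ≟ j
  ... | yes p = p
  ... | no i≢j = differ-twice {v = y} {z}
    (λ eq → xy (trans (xz′ i i≢j) (sym eq)))
    (λ eq → xz (trans (xy′ j (i≢j ∘ sym)) eq)) yz

  -- The missing diagonals make consecutive sides at `y` and at `x` differ in direction. Coordinate
  -- `i` is then constant along `yz` and along `xw`, so the change across `xy` reappears across
  -- `wz`. This recognises parallel edges by adjacency alone.
  chordless-square : ∀ {i j k l} {x y z w : Vert d q} →
    AdjAt i x y → AdjAt j y z → AdjAt k x w → AdjAt l w z →
    ¬ Adj x z → x ≢ z → ¬ Adj y w → y ≢ w → i ≡ l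
  chordless-square {i} {j} {k} {l} xy yz xw wz ¬xz x≢z ¬yw y≢w =
    differ⇒index wz λ eq → differ xy (trans (agree xw i i≢k) (trans eq (sym (agree yz i i≢j))))
    where
    i≢j : i ≢ j
    i≢j refl = ¬xz ⟪ collinear-Adj (AdjAt-sym xy) yz x≢z ⟫
    i≢k : i ≢ k
    i≢k refl = ¬yw ⟪ collinear-Adj xy xw y≢w ⟫

module Directions {d q : ℕ} (1<q : 1 < q) (v₀ : Vert d q) (g : GraphAut d q) where

  g-inj : Inj (to g)
  g-inj {v} {w} eq = trans (sym (from-to g v)) (trans (cong (from g) eq) (from-to g w))

  g-Adj⁻ : ∀ v w → Adj (to g v) (to g w) → Adj v w
  g-Adj⁻ v w a = subst₂ Adj (from-to g v) (from-to g w) (from-adj g _ _ a)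

  same-line : ∀ {i a b v w w′} → AdjAt i v w → AdjAt i v w′ →
    AdjAt a (to g v) (to g w) → AdjAt b (to g v) (to g w′) → a ≡ b
  same-line {a = a} {b} {v} {w} {w′} vw vw′ gvw gvw′ with a ≟ b
  ... | yes p = p
  ... | no a≢b = triangle gvw gvw′ (to-adj g w w′ ⟪ collinear-Adj vw vw′ w≢w′ ⟫)
    where
    w≢w′ : w ≢ w′
    w≢w′ refl = a≢b (AdjAt-unique gvw gvw′)

  -- An edge and its shift in another direction are opposite sides of a chordless square, and
  -- automorphisms preserve chordless squares.
  parallel-lines : ∀ {i j a b c v w} → AdjAt i v w → j ≢ i → lookup v j ≢ c →
    AdjAt a (to g v) (to g w) → AdjAt b (to g (v [ j ]≔ c)) (to g (w [ j ]≔ c)) → a ≡ b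
  parallel-lines {i} {j} {a} {b} {c} {v} {w} vw j≢i vj≢c gvw gvw′ =
    chordless-square gvw (at (to-adj g w z ⟪ wz ⟫)) (at (to-adj g v x ⟪ vx ⟫)) gvw′
      (¬vz ∘ g-Adj⁻ v z) (v≢z ∘ g-inj) (¬wx ∘ g-Adj⁻ w x) (w≢x ∘ g-inj)
    where
    x = v [ j ]≔ c
    z = w [ j ]≔ c
    vx : AdjAt j v x
    vx = update-AdjAt v j vj≢c
    wz : AdjAt j w z
    wz = update-AdjAt w j (λ eq → vj≢c (trans (agree vw j j≢i) eq))
    vz-i : lookup v i ≢ lookup z i
    vz-i eq = differ vw (trans eq (lookup∘update′ (j≢i ∘ sym) w c))
    vz-j : lookup v j ≢ lookup z j
    vz-j eq = vj≢c (trans eq (lookup∘update j w c))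
    wx-i : lookup w i ≢ lookup x i
    wx-i eq = differ vw (sym (trans eq (lookup∘update′ (j≢i ∘ sym) v c)))
    wx-j : lookup w j ≢ lookup x j
    wx-j eq = vj≢c (trans (agree vw j j≢i) (trans eq (lookup∘update j v c)))
    ¬vz : ¬ Adj v z
    ¬vz e = j≢i (differ-twice {v = v} {z} vz-j vz-i e)
    v≢z : v ≢ z
    v≢z eq = vz-i (cong (λ u → lookup u i) eq)
    ¬wx : ¬ Adj w x
    ¬wx e = j≢i (differ-twice {v = w} {x} wx-j wx-i e)
    w≢x : w ≢ x
    w≢x eq = wx-i (cong (λ u → lookup u i) eq)

  neighbour : ∀ (v : Vert d q) i → ∃ λ w → AdjAt i v w
  neighbour v i = v [ i ]≔ proj₁ c , update-AdjAt v i (proj₂ c)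
    where c = another 1<q (lookup v i)

  ∂ : Vert d q → Fin d → Fin d
  ∂ v i = proj₁ (to-adj g v (proj₁ (neighbour v i)) ⟪ proj₂ (neighbour v i) ⟫)

  ∂-AdjAt : ∀ {i v w} → AdjAt i v w → AdjAt (∂ v i) (to g v) (to g w)
  ∂-AdjAt {i} {v} {w} vw =
    subst (λ a → AdjAt a (to g v) (to g w))
      (same-line vw (proj₂ (neighbour v i)) gvw (at (to-adj g v (proj₁ (neighbour v i)) ⟪ proj₂ (neighbour v i) ⟫))) gvw
    where gvw = at (to-adj g v w ⟪ vw ⟫)

  -- For a move along direction `i` itself, the edge moved along has one image, read from its two
  -- ends. A move in any other direction shifts an edge of direction `i` to a parallel one.
  ∂-step : ∀ (v : Vert d q) j c i → ∂ (v [ j ]≔ c) i ≡ ∂ v i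
  ∂-step v j c i with lookup v j ≟ c
  ... | yes refl = cong (λ u → ∂ u i) ([]≔-lookup v j)
  ... | no vj≢c with j ≟ i
  ...   | yes refl = AdjAt-unique (∂-AdjAt (AdjAt-sym vw)) (AdjAt-sym (∂-AdjAt vw))
    where vw = update-AdjAt v j vj≢c
  ...   | no j≢i with neighbour v i
  ...     | w , vw = sym (parallel-lines vw j≢i vj≢c (∂-AdjAt vw) (∂-AdjAt shifted))
    where
    shifted : AdjAt i (v [ j ]≔ c) (w [ j ]≔ c)
    shifted = adjAt (λ eq → differ vw (trans (sym (lookup∘update′ (j≢i ∘ sym) v c))
                        (trans eq (lookup∘update′ (j≢i ∘ sym) w c)))) off
      where
      off : ∀ k → k ≢ i → lookup (v [ j ]≔ c) k ≡ lookup (w [ j ]≔ c) k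
      off k k≢i with k ≟ j
      ... | yes refl = trans (lookup∘update j v c) (sym (lookup∘update j w c))
      ... | no k≢j = trans (lookup∘update′ k≢j v c)
                       (trans (agree vw k k≢i) (sym (lookup∘update′ k≢j w c)))

  π : Fin d → Fin d
  π = ∂ v₀

  ∂-const : ∀ v i → ∂ v i ≡ π i
  ∂-const v i = vertex-induction (λ v → ∂ v i ≡ π i) {v₀} refl
    (λ u k c eq → trans (∂-step u k c i) eq) v

  π-AdjAt : ∀ {i v w} → AdjAt i v w → AdjAt (π i) (to g v) (to g w)
  π-AdjAt {i} {v} {w} vw = subst (λ a → AdjAt a (to g v) (to g w)) (∂-const v i) (∂-AdjAt vw)

  π-inj : Inj π
  π-inj {i} {j} eq with i ≟ j
  ... | yes p = p
  ... | no i≢j with neighbour v₀ i | neighbour v₀ j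
  ...   | w , vw | w′ , vw′ = triangle vw vw′ (g-Adj⁻ w w′ ⟪ collinear-Adj (π-AdjAt vw)
    (subst (λ a → AdjAt a (to g v₀) (to g w′)) (sym eq) (π-AdjAt vw′)) (w≢w′ ∘ g-inj) ⟫)
    where
    w≢w′ : w ≢ w′
    w≢w′ refl = i≢j (AdjAt-unique vw vw′)

  π-lookup-step : ∀ {i j} v c → j ≢ i →
    lookup (to g (v [ j ]≔ c)) (π i) ≡ lookup (to g v) (π i)
  π-lookup-step {i} {j} v c j≢i with lookup v j ≟ c
  ... | yes refl = cong (λ u → lookup (to g u) (π i)) ([]≔-lookup v j)
  ... | no vj≢c = sym (agree (π-AdjAt (update-AdjAt v j vj≢c)) (π i) (j≢i ∘ sym ∘ π-inj))

  -- This is the coordinatewise action: a change in any other direction `j` alters the image only in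
  -- direction `π j`, which differs from `π i`.
  π-lookup : ∀ {i} v w → lookup v i ≡ lookup w i → lookup (to g v) (π i) ≡ lookup (to g w) (π i)
  π-lookup {i} v w eq = trans (sym (P-all w)) (cong (λ u → lookup (to g u) (π i))
      (trans (cong (w [ i ]≔_) eq) ([]≔-lookup w i)))
    where
    P : Vert d q → Set
    -- Resetting coordinate `i` lets the induction overwrite every coordinate, including `i`.
    P u = lookup (to g (u [ i ]≔ lookup v i)) (π i) ≡ lookup (to g v) (π i)
    step : ∀ u k c → P u → P (u [ k ]≔ c)
    step u k c Pu with k ≟ i
    ... | yes refl = trans (cong (λ u → lookup (to g u) (π k)) ([]≔-idempotent u k)) Pu
    ... | no k≢i = trans (cong (λ u → lookup (to g u) (π i)) ([]≔-commutes u k i k≢i))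
                     (trans (π-lookup-step _ c k≢i) Pu)
    P-all : ∀ u → P u
    P-all = vertex-induction P {v} (cong (λ u → lookup (to g u) (π i)) ([]≔-lookup v i)) step

-- Regular maps

iter-+ : ∀ {A : Set} (f : A → A) k l x → iter f k (iter f l x) ≡ iter f (k ℕ.+ l) x
iter-+ f zero l x = refl
iter-+ f (suc k) l x = cong f (iter-+ f k l x)

iter-comm : ∀ {A : Set} (f : A → A) k l x → iter f k (iter f l x) ≡ iter f l (iter f k x)
iter-comm f k l x = begin
  iter f k (iter f l x)   ≡⟨ iter-+ f k l x ⟩
  iter f (k ℕ.+ l) x      ≡⟨ cong (λ n → iter f n x) (ℕₚ.+-comm k l) ⟩
  iter f (l ℕ.+ k) x      ≡⟨ iter-+ f l k x ⟨
  iter f l (iter f k x)   ∎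
  where open ≡-Reasoning

iter-inj : ∀ {A : Set} {f : A → A} → Inj f → ∀ k → Inj (iter f k)
iter-inj f-inj zero eq = eq
iter-inj f-inj (suc k) eq = iter-inj f-inj k (f-inj eq)

iter-fixed : ∀ {A : Set} {f : A → A} {x} → f x ≡ x → ∀ k → iter f k x ≡ x
iter-fixed fx zero = refl
iter-fixed {f = f} fx (suc k) = trans (cong f (iter-fixed fx k)) fx

module AutomorphismGroup {d q : ℕ} (M : RotationSystem d q) where

  Aut : Set
  Aut = MapIso M M

  infixr 8 _▹_
  _▹_ : Aut → Vert d q → Vert d q
  (g , _) ▹ v = to g v

  ▹-Adj : ∀ (g : Aut) v w → Adj v w → Adj (g ▹ v) (g ▹ w)
  ▹-Adj (g , _) = to-adj g

  ▹-ρ : ∀ (g : Aut) v w → Adj v w → g ▹ ρ M v w ≡ ρ M (g ▹ v) (g ▹ w)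
  ▹-ρ (_ , hom) = hom

  ▹-inj : ∀ (g : Aut) {v w} → g ▹ v ≡ g ▹ w → v ≡ w
  ▹-inj (g , _) {v} {w} eq = trans (sym (from-to g v)) (trans (cong (from g) eq) (from-to g w))

  idᴬ : Aut
  idᴬ = record
    { to = λ v → v ; from = λ v → v ; to-from = λ _ → refl ; from-to = λ _ → refl
    ; to-adj = λ _ _ a → a ; from-adj = λ _ _ a → a } , λ _ _ _ → refl

  infixl 9 _∘ᴬ_
  _∘ᴬ_ : Aut → Aut → Aut
  g@(g′ , _) ∘ᴬ h@(h′ , _) = record
    { to = λ v → g ▹ h ▹ v
    ; from = λ v → from h′ (from g′ v)
    ; to-from = λ v → trans (cong (to g′) (to-from h′ (from g′ v))) (to-from g′ v)
    ; from-to = λ v → trans (cong (from h′) (from-to g′ (to h′ v))) (from-to h′ v)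
    ; to-adj = λ v w a → to-adj g′ _ _ (to-adj h′ v w a)
    ; from-adj = λ v w a → from-adj h′ _ _ (from-adj g′ v w a)
    } , λ v w a → trans (cong (g ▹_) (▹-ρ h v w a)) (▹-ρ g _ _ (▹-Adj h v w a))

  infix 10 _⁻¹ᴬ
  _⁻¹ᴬ : Aut → Aut
  g@(g′ , _) ⁻¹ᴬ = record
    { to = from g′ ; from = to g′ ; to-from = from-to g′ ; from-to = to-from g′
    ; to-adj = from-adj g′ ; from-adj = to-adj g′ } , hom
    where
    hom : ∀ v w → Adj v w → from g′ (ρ M v w) ≡ ρ M (from g′ v) (from g′ w)
    hom v w a = ▹-inj g (begin
      g ▹ from g′ (ρ M v w)                     ≡⟨ to-from g′ _ ⟩
      ρ M v w                                   ≡⟨ cong₂ (ρ M) (to-from g′ v) (to-from g′ w) ⟨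
      ρ M (g ▹ from g′ v) (g ▹ from g′ w)       ≡⟨ ▹-ρ g _ _ (from-adj g′ v w a) ⟨
      g ▹ ρ M (from g′ v) (from g′ w)           ∎)
      where open ≡-Reasoning

  ▹-⁻¹ : ∀ (g : Aut) v → g ▹ g ⁻¹ᴬ ▹ v ≡ v
  ▹-⁻¹ (g , _) = to-from g

  ⁻¹-▹ : ∀ (g : Aut) v → g ⁻¹ᴬ ▹ g ▹ v ≡ v
  ⁻¹-▹ (g , _) = from-to g

  iter-ρ-Adj : ∀ v w → Adj v w → ∀ k → Adj v (iter (ρ M v) k w)
  iter-ρ-Adj v w a zero = a
  iter-ρ-Adj v w a (suc k) = ρ-adj M v _ (iter-ρ-Adj v w a k)

  -- Agreement on one arc spreads around its origin, because automorphisms commute with the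
  -- rotation, and then across edges to the whole graph. The induction hypothesis has to include the
  -- neighbours for the next step to start from an arc.
  rigid : ∀ (g h : Aut) v w → Adj v w → g ▹ v ≡ h ▹ v → g ▹ w ≡ h ▹ w → ∀ u → g ▹ u ≡ h ▹ u
  rigid g h v w a eqv eqw u = proj₁ (vertex-induction P {v} (eqv , around v w a eqv eqw) step u)
    where
    P : Vert d q → Set
    P u = g ▹ u ≡ h ▹ u × (∀ w → Adj u w → g ▹ w ≡ h ▹ w)
    around : ∀ v w → Adj v w → g ▹ v ≡ h ▹ v → g ▹ w ≡ h ▹ w → ∀ w′ → Adj v w′ → g ▹ w′ ≡ h ▹ w′
    around v w a eqv eqw w′ a′ with ρ-cyc M v w w′ a a′
    ... | k , refl = go k
      where
      go : ∀ k → g ▹ iter (ρ M v) k w ≡ h ▹ iter (ρ M v) k w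
      go zero = eqw
      go (suc k) = trans (▹-ρ g v _ (iter-ρ-Adj v w a k))
        (trans (cong₂ (ρ M) eqv (go k)) (sym (▹-ρ h v _ (iter-ρ-Adj v w a k))))
    step : ∀ u k c → P u → P (u [ k ]≔ c)
    step u k c Pu@(equ , eqn) with lookup u k ≟ c
    ... | yes refl = subst P (sym ([]≔-lookup u k)) Pu
    ... | no ne = eqn u′ uu′ , around u′ u (Adj-sym {v = u} {u′} uu′) (eqn u′ uu′) equ
      where
      u′ = u [ k ]≔ c
      uu′ = ⟪ update-AdjAt u k ne ⟫

-- Stabilisers of a vertex and of a line

module Regular {d q : ℕ} (1<q : 1 < q) (M : RotationSystem d q) (regular : OrientablyRegular M)
  (v₀ : Vert d q) (i₀ : Fin d) where

  open AutomorphismGroup M public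

  module D (g : Aut) = Directions 1<q v₀ (proj₁ g)

  π : Aut → Fin d → Fin d
  π g = D.π g

  π-adjAt : ∀ (g : Aut) {i v w} → AdjAt i v w → AdjAt (π g i) (g ▹ v) (g ▹ w)
  π-adjAt g = D.π-AdjAt g

  π-cong : ∀ (g h : Aut) → (∀ u → g ▹ u ≡ h ▹ u) → ∀ i → π g i ≡ π h i
  π-cong g h g≗h i with D.neighbour g v₀ i
  ... | w , a = AdjAt-unique (π-adjAt g a)
    (subst₂ (AdjAt (π h i)) (sym (g≗h v₀)) (sym (g≗h w)) (π-adjAt h a))

  π-∘ : ∀ (g h : Aut) i → π (g ∘ᴬ h) i ≡ π g (π h i)
  π-∘ g h i with D.neighbour g v₀ i
  ... | w , a = AdjAt-unique (π-adjAt (g ∘ᴬ h) a) (π-adjAt g (π-adjAt h a))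

  K : Fin q → Vert d q
  K c = v₀ [ i₀ ]≔ c

  K-i₀ : ∀ c → lookup (K c) i₀ ≡ c
  K-i₀ c = lookup∘update i₀ v₀ c

  K-off : ∀ c {j} → j ≢ i₀ → lookup (K c) j ≡ lookup v₀ j
  K-off c j≢i₀ = lookup∘update′ j≢i₀ v₀ c

  K-inj : ∀ {a b} → K a ≡ K b → a ≡ b
  K-inj {a} {b} eq = trans (sym (K-i₀ a)) (trans (cong (λ v → lookup v i₀) eq) (K-i₀ b))

  K-AdjAt : ∀ {a b} → a ≢ b → AdjAt i₀ (K a) (K b)
  K-AdjAt {a} {b} a≢b = adjAt
    (λ eq → a≢b (trans (sym (K-i₀ a)) (trans eq (K-i₀ b))))
    λ j j≢i₀ → trans (K-off a j≢i₀) (sym (K-off b j≢i₀))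

  𝟘 𝟙 : Fin q
  𝟘 = lookup v₀ i₀
  𝟙 = proj₁ (another 1<q 𝟘)

  𝟘≢𝟙 : 𝟘 ≢ 𝟙
  𝟘≢𝟙 = proj₂ (another 1<q 𝟘)

  K-𝟘 : K 𝟘 ≡ v₀
  K-𝟘 = []≔-lookup v₀ i₀

  v₀-K𝟙 : AdjAt i₀ v₀ (K 𝟙)
  v₀-K𝟙 = subst (λ v → AdjAt i₀ v (K 𝟙)) K-𝟘 (K-AdjAt 𝟘≢𝟙)

  rotation : Σ Aut λ φ → φ ▹ v₀ ≡ v₀ × φ ▹ K 𝟙 ≡ ρ M v₀ (K 𝟙)
  rotation = regular v₀ (K 𝟙) v₀ (ρ M v₀ (K 𝟙)) ⟪ v₀-K𝟙 ⟫ (ρ-adj M v₀ (K 𝟙) ⟪ v₀-K𝟙 ⟫)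

  x : Aut
  x = proj₁ rotation

  x-v₀ : x ▹ v₀ ≡ v₀
  x-v₀ = proj₁ (proj₂ rotation)

  x-iter : ∀ k → x ▹ iter (ρ M v₀) k (K 𝟙) ≡ iter (ρ M v₀) (suc k) (K 𝟙)
  x-iter zero = proj₂ (proj₂ rotation)
  x-iter (suc k) = trans (▹-ρ x v₀ _ (iter-ρ-Adj v₀ (K 𝟙) ⟪ v₀-K𝟙 ⟫ k))
    (cong₂ (ρ M) x-v₀ (x-iter k))

  -- Regularity prescribes `x` at the single neighbour `K 𝟙`; the others are its iterates under the
  -- rotation at `v₀`, with which `x` commutes.
  x-ρ : ∀ w → Adj v₀ w → x ▹ w ≡ ρ M v₀ w
  x-ρ w a with ρ-cyc M v₀ (K 𝟙) w ⟪ v₀-K𝟙 ⟫ a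
  ... | k , refl = x-iter k

  pow : ℕ → Aut
  pow zero = idᴬ
  pow (suc k) = x ∘ᴬ pow k

  pow-▹ : ∀ k v → pow k ▹ v ≡ iter (x ▹_) k v
  pow-▹ zero v = refl
  pow-▹ (suc k) v = cong (x ▹_) (pow-▹ k v)

  π-pow : ∀ k i → π (pow k) i ≡ iter (π x) k i
  π-pow zero i with D.neighbour idᴬ v₀ i
  ... | w , a = AdjAt-unique (π-adjAt idᴬ a) a
  π-pow (suc k) i = trans (π-∘ x (pow k) i) (cong (π x) (π-pow k i))

  pow-v₀ : ∀ k → pow k ▹ v₀ ≡ v₀
  pow-v₀ k = trans (pow-▹ k v₀) (iter-fixed {f = x ▹_} x-v₀ k)

  iter-ρ : ∀ w → Adj v₀ w → ∀ k → pow k ▹ w ≡ iter (ρ M v₀) k w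
  iter-ρ w a zero = refl
  iter-ρ w a (suc k) = trans (cong (x ▹_) (iter-ρ w a k)) (x-ρ _ (iter-ρ-Adj v₀ w a k))

  pow-transitive : ∀ w w′ → Adj v₀ w → Adj v₀ w′ → ∃ λ k → pow k ▹ w ≡ w′
  pow-transitive w w′ a a′ with ρ-cyc M v₀ w w′ a a′
  ... | k , eq = k , trans (iter-ρ w a k) eq

  stabilizer-cyclic : ∀ (g : Aut) → g ▹ v₀ ≡ v₀ → ∃ λ k → ∀ u → g ▹ u ≡ pow k ▹ u
  stabilizer-cyclic g gv₀ with pow-transitive (K 𝟙) (g ▹ K 𝟙) ⟪ v₀-K𝟙 ⟫
    (subst (λ v → Adj v (g ▹ K 𝟙)) gv₀ (▹-Adj g v₀ (K 𝟙) ⟪ v₀-K𝟙 ⟫))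
  ... | k , eq = k , rigid g (pow k) v₀ (K 𝟙) ⟪ v₀-K𝟙 ⟫ (trans gv₀ (sym (pow-v₀ k))) (sym eq)

  πx-transitive : ∀ i j → ∃ λ l → iter (π x) l i ≡ j
  πx-transitive i j with D.neighbour x v₀ i | D.neighbour x v₀ j
  ... | w , a | w′ , a′ with pow-transitive w w′ ⟪ a ⟫ ⟪ a′ ⟫
  ...   | l , eq = l , trans (sym (π-pow l i)) (AdjAt-unique
    (subst₂ (AdjAt (π (pow l) i)) (pow-v₀ l) eq (π-adjAt (pow l) a)) a′)

  -- The stabiliser of `v₀` acts on directions as an abelian transitive group, and in such a group
  -- an element with one fixed point is the identity.
  stabilizer-π : ∀ (g : Aut) → g ▹ v₀ ≡ v₀ → ∀ {j} → π g j ≡ j → ∀ i → π g i ≡ i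
  stabilizer-π g gv₀ {j} gj i with stabilizer-cyclic g gv₀ | πx-transitive j i
  ... | k , g≗ | l , refl = begin
    π g (iter (π x) l j)              ≡⟨ π-g (iter (π x) l j) ⟩
    iter (π x) k (iter (π x) l j)     ≡⟨ iter-comm (π x) k l j ⟩
    iter (π x) l (iter (π x) k j)     ≡⟨ cong (iter (π x) l) (trans (sym (π-g j)) gj) ⟩
    iter (π x) l j                    ∎
    where
    open ≡-Reasoning
    π-g : ∀ i → π g i ≡ iter (π x) k i
    π-g i = trans (π-cong g (pow k) g≗ i) (π-pow k i)

  PreservesLine : Aut → Set
  PreservesLine g = ∀ c → g ▹ K c ≡ K (lookup (g ▹ K c) i₀)

  preservesLine : ∀ (g : Aut) {a b} → π g i₀ ≡ i₀ → g ▹ K a ≡ K b → PreservesLine g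
  preservesLine g {a} {b} πg ga c = vec-ext go
    where
    off : ∀ j → j ≢ i₀ → lookup (g ▹ K c) j ≡ lookup (g ▹ K a) j
    off j j≢i₀ with c ≟ a
    ... | yes refl = refl
    ... | no c≢a = agree (π-adjAt g (K-AdjAt c≢a)) j (λ eq → j≢i₀ (trans eq πg))
    go : ∀ j → lookup (g ▹ K c) j ≡ lookup (K (lookup (g ▹ K c) i₀)) j
    go j with j ≟ i₀
    ... | yes refl = sym (K-i₀ _)
    ... | no j≢i₀ = begin
      lookup (g ▹ K c) j        ≡⟨ off j j≢i₀ ⟩
      lookup (g ▹ K a) j        ≡⟨ cong (λ v → lookup v j) ga ⟩
      lookup (K b) j            ≡⟨ K-off b j≢i₀ ⟩
      lookup v₀ j               ≡⟨ K-off _ j≢i₀ ⟨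
      lookup (K _) j            ∎
      where open ≡-Reasoning

  LineStabilizer : Set
  LineStabilizer = Σ Aut PreservesLine

  infixr 8 _·_
  _·_ : LineStabilizer → Fin q → Fin q
  (g , _) · c = lookup (g ▹ K c) i₀

  ·-inj : ∀ (g : LineStabilizer) {a b} → g · a ≡ g · b → a ≡ b
  ·-inj (g , pg) {a} {b} eq = K-inj (▹-inj g (trans (pg a) (trans (cong K eq) (sym (pg b)))))

  line-π : ∀ ((g , _) : LineStabilizer) → π g i₀ ≡ i₀
  line-π G@(g , pg) = AdjAt-unique (π-adjAt g (K-AdjAt 𝟘≢𝟙))
    (subst₂ (AdjAt i₀) (sym (pg 𝟘)) (sym (pg 𝟙)) (K-AdjAt (𝟘≢𝟙 ∘ ·-inj G)))

  line-rigid : ∀ (g h : LineStabilizer) {a b} → a ≢ b → g · a ≡ h · a → g · b ≡ h · b →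
    ∀ u → proj₁ g ▹ u ≡ proj₁ h ▹ u
  line-rigid (g , pg) (h , ph) {a} {b} a≢b eqa eqb =
    rigid g h (K a) (K b) ⟪ K-AdjAt a≢b ⟫
      (trans (pg a) (trans (cong K eqa) (sym (ph a))))
      (trans (pg b) (trans (cong K eqb) (sym (ph b))))

  line-v₀ : ∀ (g : LineStabilizer) → g · 𝟘 ≡ 𝟘 → proj₁ g ▹ v₀ ≡ v₀
  line-v₀ (g , pg) g0 = begin
    g ▹ v₀                       ≡⟨ cong (g ▹_) K-𝟘 ⟨
    g ▹ K 𝟘                      ≡⟨ pg 𝟘 ⟩
    K (lookup (g ▹ K 𝟘) i₀)      ≡⟨ cong K g0 ⟩
    K 𝟘                          ≡⟨ K-𝟘 ⟩
    v₀                           ∎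
    where open ≡-Reasoning

  line-∘ : LineStabilizer → LineStabilizer → LineStabilizer
  line-∘ (g , pg) (h , ph) = g ∘ᴬ h , λ c → begin
    g ▹ h ▹ K c                                  ≡⟨ cong (g ▹_) (ph c) ⟩
    g ▹ K (lookup (h ▹ K c) i₀)                  ≡⟨ pg _ ⟩
    K (lookup (g ▹ K (lookup (h ▹ K c) i₀)) i₀)  ≡⟨ cong (λ v → K (lookup (g ▹ v) i₀)) (ph c) ⟨
    K (lookup (g ▹ h ▹ K c) i₀)                  ∎
    where open ≡-Reasoning

  line-⁻¹ : LineStabilizer → LineStabilizer
  line-⁻¹ G@(g , pg) = g ⁻¹ᴬ , preserves
    where
    -- Finiteness is used: `g` maps the line injectively into itself, hence onto itself.
    preserves : PreservesLine (g ⁻¹ᴬ)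
    preserves c with inj⇒surj (G ·_) (·-inj G) c
    ... | b , refl = trans eq (cong K (sym (trans (cong (λ v → lookup v i₀) eq) (K-i₀ b))))
      where
      eq : g ⁻¹ᴬ ▹ K (G · b) ≡ K b
      eq = trans (cong (g ⁻¹ᴬ ▹_) (sym (pg b))) (⁻¹-▹ g (K b))

  -- Arc-transitivity is applied to two arcs inside the line; as both have direction `i₀`, the
  -- automorphism obtained keeps that direction and with it the line.
  line-trans₂ : ∀ {a b c d} → a ≢ b → c ≢ d → ∃ λ (g : LineStabilizer) → g · a ≡ c × g · b ≡ d
  line-trans₂ {a} {b} {c} {d} a≢b c≢d
    with regular (K a) (K b) (K c) (K d) ⟪ K-AdjAt a≢b ⟫ ⟪ K-AdjAt c≢d ⟫
  ... | g , ga , gb = (g , preservesLine g πg ga) ,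
    trans (cong (λ v → lookup v i₀) ga) (K-i₀ c) , trans (cong (λ v → lookup v i₀) gb) (K-i₀ d)
    where
    πg : π g i₀ ≡ i₀
    πg = AdjAt-unique (π-adjAt g (K-AdjAt a≢b)) (subst₂ (AdjAt i₀) (sym ga) (sym gb) (K-AdjAt c≢d))

  line-comm : ∀ (g h : LineStabilizer) → g · 𝟘 ≡ 𝟘 → h · 𝟘 ≡ 𝟘 → ∀ c → g · h · c ≡ h · g · c
  line-comm G@(g , pg) H@(h , ph) g0 h0 c
    with stabilizer-cyclic g (line-v₀ G g0) | stabilizer-cyclic h (line-v₀ H h0)
  ... | k , g≗ | l , h≗ = cong (λ v → lookup v i₀) (begin
    g ▹ K (lookup (h ▹ K c) i₀)           ≡⟨ cong (g ▹_) (ph c) ⟨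
    g ▹ h ▹ K c                           ≡⟨ trans (g≗ _) (cong (pow k ▹_) (h≗ _)) ⟩
    pow k ▹ pow l ▹ K c                   ≡⟨ pow-pow k l ⟩
    iter (x ▹_) k (iter (x ▹_) l (K c))   ≡⟨ iter-comm (x ▹_) k l (K c) ⟩
    iter (x ▹_) l (iter (x ▹_) k (K c))   ≡⟨ pow-pow l k ⟨
    pow l ▹ pow k ▹ K c                   ≡⟨ trans (h≗ _) (cong (pow l ▹_) (g≗ _)) ⟨
    h ▹ g ▹ K c                           ≡⟨ cong (h ▹_) (pg c) ⟩
    h ▹ K (lookup (g ▹ K c) i₀)           ∎)
    where
    open ≡-Reasoning
    pow-pow : ∀ k l → pow k ▹ pow l ▹ K c ≡ iter (x ▹_) k (iter (x ▹_) l (K c))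
    pow-pow k l = trans (pow-▹ k _) (cong (iter (x ▹_) k) (pow-▹ l (K c)))

  line-sharply2Transitive : Sharply2Transitive q
  line-sharply2Transitive = record
    { G = LineStabilizer
    ; _·_ = _·_
    ; _∙_ = line-∘
    ; ι = idᴬ , λ c → cong K (sym (K-i₀ c))
    ; _⁻¹ = line-⁻¹
    ; ∙-act = λ (g , _) (h , ph) c → cong (λ v → lookup (g ▹ v) i₀) (ph c)
    ; ι-act = K-i₀
    ; ⁻¹-actˡ = λ (g , pg) c → trans (cong (λ v → lookup (g ⁻¹ᴬ ▹ v) i₀) (sym (pg c)))
        (trans (cong (λ v → lookup v i₀) (⁻¹-▹ g (K c))) (K-i₀ c))
    ; ⁻¹-actʳ = λ G@(g , pg) c → trans (cong (λ v → lookup (g ▹ v) i₀) (sym (proj₂ (line-⁻¹ G) c)))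
        (trans (cong (λ v → lookup v i₀) (▹-⁻¹ g (K c))) (K-i₀ c))
    ; trans₂ = line-trans₂
    ; sharp = λ {g} {h} a≢b eqa eqb c → cong (λ v → lookup v i₀) (line-rigid g h a≢b eqa eqb (K c))
    ; 𝟘 = 𝟘 ; 𝟙 = 𝟙 ; 𝟘≢𝟙 = 𝟘≢𝟙
    ; stabilizer-comm = line-comm }

-- Translations of a line

-- These are the facts about the constructed field that the geometry uses. What follows takes the
-- record as a parameter, so the field operations never unfold into choices of group elements.
record AffineField {q : ℕ} (S : Sharply2Transitive q) : Set where
  open Sharply2Transitive S
  field
    F : FieldOn q
  open FieldOn F
  field
    0#≡𝟘      : 0# ≡ 𝟘
    1#≡𝟙      : 1# ≡ 𝟙
    translate : ∀ u → ∃ λ g → ∀ v → g · v ≡ u + v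
    stabilizer-scales : ∀ g → g · 𝟘 ≡ 𝟘 → ∀ v → g · v ≡ (g · 𝟙) * v

affineField : ∀ {q} (S : Sharply2Transitive q) → AffineField S
affineField S = record
  { F = field-on ; 0#≡𝟘 = refl ; 1#≡𝟙 = refl
  ; translate = λ u → τ u , λ _ → refl
  ; stabilizer-scales = stabilizer-⊗ }
  where open NearField S

-- The point is c = u / (m - 1): the translation by `u` and a scaling by `m` other than 1 always
-- agree somewhere.
affine-fixed-point : ∀ {q} (F : FieldOn q) → let open FieldOn F in
  ∀ {m} → m ≢ 1# → ∀ u → ∃ λ c → u + c ≡ m * c
affine-fixed-point F {m} m≢1 u with FieldOn.inverse F (m + - 1#) m-1≢0
  where
  open CommutativeRing (ringOf F) using (_+_; -_; 1#; 0#; +-group)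
  open import Algebra.Properties.Group +-group using (inverseˡ-unique; ⁻¹-involutive)
  m-1≢0 : m + - 1# ≢ 0#
  m-1≢0 eq = m≢1 (trans (inverseˡ-unique m (- 1#) eq) (⁻¹-involutive 1#))
... | y , eq = c , (begin
  u + c                           ≡⟨ cong (_+ c) (*-identityʳ u) ⟨
  u * 1# + c                      ≡⟨ cong (λ z → u * z + c) eq ⟨
  u * ((m + - 1#) * y) + c        ≡⟨ cong (_+ c) (x∙yz≈y∙xz u (m + - 1#) y) ⟩
  (m + - 1#) * c + c              ≡⟨ cong ((m + - 1#) * c +_) (*-identityˡ c) ⟨
  (m + - 1#) * c + 1# * c         ≡⟨ distribʳ c (m + - 1#) 1# ⟨
  (m + - 1# + 1#) * c             ≡⟨ cong (_* c) (+-assoc m (- 1#) 1#) ⟩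
  (m + (- 1# + 1#)) * c           ≡⟨ cong (λ z → (m + z) * c) (-‿inverseˡ 1#) ⟩
  (m + 0#) * c                    ≡⟨ cong (_* c) (+-identityʳ m) ⟩
  m * c                           ∎)
  where
  open CommutativeRing (ringOf F)
    using (_+_; _*_; -_; 1#; 0#; *-identityʳ; *-identityˡ; distribʳ; +-assoc; -‿inverseˡ; +-identityʳ;
           *-commutativeSemigroup)
  open import Algebra.Properties.CommutativeSemigroup *-commutativeSemigroup using (x∙yz≈y∙xz)
  open ≡-Reasoning
  c = u * y

third : ∀ {q} → 2 < q → (a b : Fin q) → ∃ λ c → c ≢ a × c ≢ b
third {suc (suc (suc q))} 2<q a b with zero ≟ a | zero ≟ b
... | no 0≢a | no 0≢b = zero , 0≢a , 0≢b
... | yes refl | _ with suc zero ≟ b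
...   | no 1≢b = suc zero , (λ ()) , 1≢b
...   | yes refl = suc (suc zero) , (λ ()) , λ ()
third {suc (suc (suc q))} 2<q a b | no _ | yes refl with suc zero ≟ a
...   | no 1≢a = suc zero , 1≢a , λ ()
...   | yes refl = suc (suc zero) , (λ ()) , λ ()
third {suc zero} (ℕ.s≤s ()) _ _
third {suc (suc zero)} (ℕ.s≤s (ℕ.s≤s ())) _ _

module LineTranslations {d q : ℕ} (2<q : 2 < q) (1<q : 1 < q) (M : RotationSystem d q)
  (regular : OrientablyRegular M) (v₀ : Vert d q) (i₀ : Fin d)
  (A : AffineField (Regular.line-sharply2Transitive 1<q M regular v₀ i₀)) where

  open Regular 1<q M regular v₀ i₀ public
  open AffineField A public
  open CommutativeRing (ringOf F) public
    using (_+_; _*_; -_; 0#; +-assoc; +-comm; +-identityʳ; +-identityˡ; distribˡ; -‿inverseˡ)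

  π-preimage : ∀ (g : Aut) i → ∃ λ j → π g j ≡ i
  π-preimage g i = inj⇒surj (π g) (D.π-inj g) i

  line-stabilizer-π : ∀ (h : LineStabilizer) → h · 𝟘 ≡ 𝟘 → ∀ i → π (proj₁ h) i ≡ i
  line-stabilizer-π H@(h , _) h0 = stabilizer-π h (line-v₀ H h0) (line-π H)

  -- On the line u + (m + c v) = c (m + v), so `t s h` and `h s` agree there and by rigidity
  -- everywhere. As `h` fixes `v₀` and direction `i₀`, it fixes all directions and drops out.
  commutator-π : ∀ (t s h : LineStabilizer) {u m c} →
    (∀ v → t · v ≡ u + v) → (∀ v → s · v ≡ m + v) → h · 𝟘 ≡ 𝟘 → h · 𝟙 ≡ c → u + m ≡ c * m →
    ∀ j → π (proj₁ t) (π (proj₁ s) j) ≡ π (proj₁ s) j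
  commutator-π T@(t , pt) S@(s , ps) H@(h , ph) {u} {m} {c} t+ s+ h0 h1 u+m j = begin
    π t (π s j)          ≡⟨ π-∘ t s j ⟨
    π (t ∘ᴬ s) j         ≡⟨ cong (π (t ∘ᴬ s)) (line-stabilizer-π H h0 j) ⟨
    π (t ∘ᴬ s) (π h j)   ≡⟨ π-∘ (t ∘ᴬ s) h j ⟨
    π (t ∘ᴬ s ∘ᴬ h) j    ≡⟨ π-cong (t ∘ᴬ s ∘ᴬ h) (h ∘ᴬ s)
                              (line-rigid (line-∘ (line-∘ T S) H) (line-∘ H S) 𝟘≢𝟙 (tsh≡hs 𝟘) (tsh≡hs 𝟙)) j ⟩
    π (h ∘ᴬ s) j         ≡⟨ π-∘ h s j ⟩
    π h (π s j)          ≡⟨ line-stabilizer-π H h0 (π s j) ⟩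
    π s j                ∎
    where
    open ≡-Reasoning
    h* : ∀ v → H · v ≡ c * v
    h* v = trans (stabilizer-scales H h0 v) (cong (_* v) h1)
    tsh≡hs : ∀ v → line-∘ (line-∘ T S) H · v ≡ line-∘ H S · v
    tsh≡hs v = begin
      lookup (t ▹ s ▹ h ▹ K v) i₀   ≡⟨ cong (λ w → lookup (t ▹ s ▹ w) i₀) (ph v) ⟩
      lookup (t ▹ s ▹ K (H · v)) i₀ ≡⟨ cong (λ w → lookup (t ▹ w) i₀) (ps (H · v)) ⟩
      T · S · H · v                 ≡⟨ t+ _ ⟩
      u + (S · H · v)               ≡⟨ cong (u +_) (trans (s+ _) (cong (m +_) (h* v))) ⟩
      u + (m + c * v)               ≡⟨ +-assoc u m (c * v) ⟨
      u + m + c * v                 ≡⟨ cong (_+ c * v) u+m ⟩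
      c * m + c * v                 ≡⟨ distribˡ c m v ⟨
      c * (m + v)                   ≡⟨ trans (h* _) (cong (c *_) (s+ v)) ⟨
      H · S · v                     ≡⟨ cong (λ w → lookup (h ▹ w) i₀) (ps v) ⟨
      lookup (h ▹ s ▹ K v) i₀       ∎

  -- Translations are commutators with scalings: if u + m = c m then x ↦ u + x
  -- is [x ↦ c x, x ↦ m + x], and scalings preserve all directions.
  translation-π : ∀ (t : LineStabilizer) {u} → (∀ v → t · v ≡ u + v) → ∀ i → π (proj₁ t) i ≡ i
  translation-π t {u} t+ i = begin
    π (proj₁ t) i                  ≡⟨ cong (π (proj₁ t)) πj ⟨
    π (proj₁ t) (π (proj₁ s) j)    ≡⟨ commutator-π t s h t+ (proj₂ (translate m)) h0 h1 (proj₂ fixed) j ⟩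
    π (proj₁ s) j                  ≡⟨ πj ⟩
    i                              ∎
    where
    open ≡-Reasoning
    found : ∃ λ c → c ≢ 𝟘 × c ≢ 𝟙
    found = third 2<q 𝟘 𝟙
    c : Fin q
    c = proj₁ found
    scaling : ∃ λ (h : LineStabilizer) → h · 𝟘 ≡ 𝟘 × h · 𝟙 ≡ c
    scaling = line-trans₂ 𝟘≢𝟙 (proj₁ (proj₂ found) ∘ sym)
    h : LineStabilizer
    h = proj₁ scaling
    h0 : h · 𝟘 ≡ 𝟘
    h0 = proj₁ (proj₂ scaling)
    h1 : h · 𝟙 ≡ c
    h1 = proj₂ (proj₂ scaling)
    fixed : ∃ λ m → u + m ≡ c * m
    fixed = affine-fixed-point F (λ eq → proj₂ (proj₂ found) (trans eq 1#≡𝟙)) u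
    m : Fin q
    m = proj₁ fixed
    s : LineStabilizer
    s = proj₁ (translate m)
    -- The auxiliary translation `s` is not yet known to fix directions; it is enough that it
    -- permutes them, so that `i` occurs among the images.
    j : Fin d
    j = proj₁ (π-preimage (proj₁ s) i)
    πj : π (proj₁ s) j ≡ i
    πj = proj₂ (π-preimage (proj₁ s) i)

  π-fixed-lookup : ∀ (g : Aut) {j} → π g j ≡ j → ∀ v w → lookup v j ≡ lookup w j →
    lookup (g ▹ v) j ≡ lookup (g ▹ w) j
  π-fixed-lookup g {j} πg v w eq =
    subst (λ i → lookup (g ▹ v) i ≡ lookup (g ▹ w) i) πg (D.π-lookup g v w eq)

  line-off : ∀ ((t , _) : LineStabilizer) {j} → j ≢ i₀ → lookup (t ▹ v₀) j ≡ lookup v₀ j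
  line-off (t , pt) {j} j≢i₀ = begin
    lookup (t ▹ v₀) j      ≡⟨ cong (λ v → lookup (t ▹ v) j) K-𝟘 ⟨
    lookup (t ▹ K 𝟘) j     ≡⟨ cong (λ v → lookup v j) (pt 𝟘) ⟩
    lookup (K _) j         ≡⟨ K-off _ j≢i₀ ⟩
    lookup v₀ j            ∎
    where open ≡-Reasoning

  translation-fixing-v₀ : ∀ (t : LineStabilizer) {u} → (∀ v → t · v ≡ u + v) → t · 𝟘 ≡ 𝟘 →
    ∀ v → proj₁ t ▹ v ≡ v
  translation-fixing-v₀ T@(t , pt) {u} t+ t0 =
    rigid t idᴬ (K 𝟘) (K 𝟙) ⟪ K-AdjAt 𝟘≢𝟙 ⟫ (fixes-K 𝟘) (fixes-K 𝟙)
    where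
    u≡0 : u ≡ 0#
    u≡0 = trans (sym (+-identityʳ u)) (trans (sym (t+ 0#)) (trans (cong (T ·_) 0#≡𝟘) (trans t0 (sym 0#≡𝟘))))
    fixes-K : ∀ c → t ▹ K c ≡ K c
    fixes-K c = trans (pt c) (cong K (trans (t+ c) (trans (cong (_+ c) u≡0) (+-identityˡ c))))

  -- The second endpoint of the common arc is `K c` with its `j`-th coordinate set to `r`. Its image
  -- has `j`-th coordinate as at `v₀ [ j ]≔ r` and all others as at `K c`, and the two maps agree on
  -- both.
  meeting⇒≗ : ∀ (t h : LineStabilizer) → (∀ i → π (proj₁ t) i ≡ i) → (∀ i → π (proj₁ h) i ≡ i) →
    ∀ {c} → t · c ≡ h · c → ∀ {j} → j ≢ i₀ → ∀ {r} → lookup v₀ j ≢ r →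
    lookup (proj₁ t ▹ (v₀ [ j ]≔ r)) j ≡ lookup (proj₁ h ▹ (v₀ [ j ]≔ r)) j →
    ∀ v → proj₁ t ▹ v ≡ proj₁ h ▹ v
  meeting⇒≗ (t , pt) (h , ph) πt πh {c} tc≡hc {j} j≢i₀ {r} v₀j≢r t-r≡h-r =
    rigid t h (K c) w
      ⟪ update-AdjAt (K c) j (λ eq → v₀j≢r (trans (sym (K-off c j≢i₀)) eq)) ⟫ tK≡hK (vec-ext tw≡hw)
    where
    w : Vert d q
    w = K c [ j ]≔ r
    tK≡hK : t ▹ K c ≡ h ▹ K c
    tK≡hK = trans (pt c) (trans (cong K tc≡hc) (sym (ph c)))
    w-j : lookup w j ≡ lookup (v₀ [ j ]≔ r) j
    w-j = trans (lookup∘update j (K c) r) (sym (lookup∘update j v₀ r))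
    tw≡hw : ∀ k → lookup (t ▹ w) k ≡ lookup (h ▹ w) k
    tw≡hw k with k ≟ j
    ... | yes refl = trans (π-fixed-lookup t (πt k) w _ w-j)
      (trans t-r≡h-r (sym (π-fixed-lookup h (πh k) w _ w-j)))
    ... | no k≢j = trans (π-fixed-lookup t (πt k) w (K c) (lookup∘update′ k≢j (K c) r))
      (trans (cong (λ v → lookup v k) tK≡hK)
        (sym (π-fixed-lookup h (πh k) w (K c) (lookup∘update′ k≢j (K c) r))))

  -- Suppose the translation t sends the neighbour v₀[j]≔r of v₀ to a vertex with
  -- j-th coordinate r′, and let h fix v₀ and send v₀[j]≔r to v₀[j]≔r′.  If h is
  -- not the identity then it agrees with t at some point K c of the line, hence
  -- also at the neighbour (K c)[j]≔r, and so t = h has a fixed point.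
  translation-off-v₀ : ∀ (t : LineStabilizer) {u} → (∀ v → t · v ≡ u + v) →
    ∀ {j} → j ≢ i₀ → ∀ r → lookup v₀ j ≢ r → lookup (proj₁ t ▹ (v₀ [ j ]≔ r)) j ≡ r
  translation-off-v₀ T@(t , pt) {u} t+ {j} j≢i₀ r v₀j≢r =
    conclude (H · 𝟙 ≟ 𝟙)
    where
    n : Vert d q
    n = v₀ [ j ]≔ r
    r′ : Fin q
    r′ = lookup (t ▹ n) j
    πt : ∀ i → π t i ≡ i
    πt = translation-π T t+
    v₀j≢r′ : lookup v₀ j ≢ r′
    v₀j≢r′ eq = differ (subst (λ i → AdjAt i (t ▹ v₀) (t ▹ n)) (πt j)
      (π-adjAt t (update-AdjAt v₀ j v₀j≢r))) (trans (line-off T j≢i₀) eq)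
    found : Σ Aut λ h → h ▹ v₀ ≡ v₀ × h ▹ n ≡ v₀ [ j ]≔ r′
    found = regular v₀ n v₀ (v₀ [ j ]≔ r′)
      ⟪ update-AdjAt v₀ j v₀j≢r ⟫ ⟪ update-AdjAt v₀ j v₀j≢r′ ⟫
    h : Aut
    h = proj₁ found
    hv₀ : h ▹ v₀ ≡ v₀
    hv₀ = proj₁ (proj₂ found)
    hn : h ▹ n ≡ v₀ [ j ]≔ r′
    hn = proj₂ (proj₂ found)
    πh : ∀ i → π h i ≡ i
    πh = stabilizer-π h hv₀ (AdjAt-unique (π-adjAt h (update-AdjAt v₀ j v₀j≢r))
      (subst₂ (AdjAt j) (sym hv₀) (sym hn) (update-AdjAt v₀ j v₀j≢r′)))
    H : LineStabilizer
    H = h , preservesLine h (πh i₀) (trans (cong (h ▹_) K-𝟘) (trans hv₀ (sym K-𝟘)))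
    h0 : H · 𝟘 ≡ 𝟘
    h0 = cong (λ v → lookup v i₀) (trans (cong (h ▹_) K-𝟘) hv₀)
    h-r : r′ ≡ lookup (h ▹ n) j
    h-r = sym (trans (cong (λ v → lookup v j) hn) (lookup∘update j v₀ r′))
    t≗h⇒t-id : (∀ v → t ▹ v ≡ h ▹ v) → t ▹ n ≡ n
    t≗h⇒t-id t≗h = translation-fixing-v₀ T t+ (trans (cong (λ v → lookup v i₀) (t≗h (K 𝟘))) h0) n
    fixes-n : ∀ (g : Aut) → r′ ≡ lookup (g ▹ n) j → g ▹ n ≡ n → r′ ≡ r
    fixes-n g r′≡ gn = trans r′≡ (trans (cong (λ v → lookup v j) gn) (lookup∘update j v₀ r))
    conclude : Dec (H · 𝟙 ≡ 𝟙) → r′ ≡ r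
    conclude (yes h1) = fixes-n h h-r
      (rigid h idᴬ v₀ (K 𝟙) ⟪ v₀-K𝟙 ⟫ hv₀ (trans (proj₂ H 𝟙) (cong K h1)) n)
    conclude (no h1≢) = fixes-n t refl (t≗h⇒t-id (meeting⇒≗ T H πt πh
      (trans (t+ (proj₁ meeting)) (trans (proj₂ meeting) (sym (stabilizer-scales H h0 (proj₁ meeting)))))
      j≢i₀ v₀j≢r h-r))
      where
      meeting : ∃ λ c → u + c ≡ (H · 𝟙) * c
      meeting = affine-fixed-point F {H · 𝟙} (λ eq → h1≢ (trans eq 1#≡𝟙)) u

  -- Since all directions are fixed, each coordinate of the image can be evaluated at a convenient
  -- vertex: on the line for `i₀`, and at `v₀` or one of its neighbours for the others.
  translation-▹ : ∀ (t : LineStabilizer) {u} → (∀ v → t · v ≡ u + v) →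
    ∀ v → proj₁ t ▹ v ≡ v [ i₀ ]≔ (u + lookup v i₀)
  translation-▹ T@(t , pt) {u} t+ v = vec-ext go
    where
    open ≡-Reasoning
    πt : ∀ i → π t i ≡ i
    πt = translation-π T t+
    off : ∀ j → j ≢ i₀ → Dec (lookup v₀ j ≡ lookup v j) → lookup (t ▹ v) j ≡ lookup v j
    off j j≢i₀ (yes eq) = trans (π-fixed-lookup t (πt j) v v₀ (sym eq)) (trans (line-off T j≢i₀) eq)
    off j j≢i₀ (no ne) = trans (π-fixed-lookup t (πt j) v _ (sym (lookup∘update j v₀ (lookup v j))))
      (translation-off-v₀ T t+ j≢i₀ (lookup v j) ne)
    go : ∀ j → lookup (t ▹ v) j ≡ lookup (v [ i₀ ]≔ (u + lookup v i₀)) j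
    go j with j ≟ i₀
    ... | yes refl = begin
      lookup (t ▹ v) i₀                 ≡⟨ π-fixed-lookup t (πt i₀) v _ (sym (K-i₀ (lookup v i₀))) ⟩
      T · lookup v i₀                   ≡⟨ t+ _ ⟩
      u + lookup v i₀                   ≡⟨ lookup∘update i₀ v _ ⟨
      lookup (v [ i₀ ]≔ _) i₀           ∎
    ... | no j≢i₀ = trans (off j j≢i₀ (lookup v₀ j ≟ lookup v j)) (sym (lookup∘update′ j≢i₀ v _))

  conjugate-translation-off : ∀ (y : Aut) (t : LineStabilizer) {u} → (∀ v → t · v ≡ u + v) →
    ∀ v {i} → i ≢ i₀ → lookup (y ▹ proj₁ t ▹ y ⁻¹ᴬ ▹ v) (π y i) ≡ lookup v (π y i)
  conjugate-translation-off y T@(t , _) {u} t+ v {i} i≢i₀ = begin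
    lookup (y ▹ t ▹ w) (π y i)   ≡⟨ D.π-lookup y (t ▹ w) w (trans (cong (λ v → lookup v i) (translation-▹ T t+ w))
                                      (lookup∘update′ i≢i₀ w _)) ⟩
    lookup (y ▹ w) (π y i)       ≡⟨ cong (λ v → lookup v (π y i)) (▹-⁻¹ y v) ⟩
    lookup v (π y i)             ∎
    where
    open ≡-Reasoning
    w = y ⁻¹ᴬ ▹ v

  conjugate-translation-at : ∀ (y : Aut) (t : LineStabilizer) {u} → (∀ v → t · v ≡ u + v) →
    ∀ v {c} → lookup v (π y i₀) ≡ lookup (y ▹ K c) (π y i₀) →
    lookup (y ▹ proj₁ t ▹ y ⁻¹ᴬ ▹ v) (π y i₀) ≡ lookup (y ▹ K (u + c)) (π y i₀)
  conjugate-translation-at y T@(t , _) {u} t+ v {c} eq =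
    D.π-lookup y (t ▹ w) (K (u + c)) (begin
      lookup (t ▹ w) i₀                    ≡⟨ cong (λ v → lookup v i₀) (translation-▹ T t+ w) ⟩
      lookup (w [ i₀ ]≔ (u + lookup w i₀)) i₀ ≡⟨ lookup∘update i₀ w _ ⟩
      u + lookup w i₀                      ≡⟨ cong (u +_) w-i₀ ⟩
      u + c                                ≡⟨ K-i₀ (u + c) ⟨
      lookup (K (u + c)) i₀                ∎)
    where
    open ≡-Reasoning
    w = y ⁻¹ᴬ ▹ v
    -- Different points of the line have `y`-images that differ in coordinate `π y i₀`, so this
    -- coordinate of `v` determines `c`.
    w-i₀ : lookup w i₀ ≡ c
    w-i₀ with lookup w i₀ ≟ c
    ... | yes p = p
    ... | no ne = contradiction
      (trans (sym (D.π-lookup y w (K (lookup w i₀)) (sym (K-i₀ _))))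
        (trans (cong (λ v → lookup v (π y i₀)) (▹-⁻¹ y v)) eq))
      (differ (π-adjAt y (K-AdjAt ne)))

-- Coordinates

lookup-init : ∀ {A : Set} {n} (v : Vec A (suc n)) i → lookup (init v) i ≡ lookup v (inject₁ i)
lookup-init (x ∷ y ∷ v) zero = refl
lookup-init (x ∷ y ∷ v) (suc i) = lookup-init (y ∷ v) i

last-lookup : ∀ {A : Set} {n} (v : Vec A (suc n)) → last v ≡ lookup v (fromℕ n)
last-lookup (x ∷ []) = refl
last-lookup (x ∷ y ∷ v) = last-lookup (y ∷ v)

module CyclicPermutation {d : ℕ} (σ : Fin d → Fin d) (σ-inj : Inj σ) (i₀ : Fin d)
  (transitive : ∀ j → ∃ λ l → iter σ l i₀ ≡ j) where

  iter-% : ∀ {m} .{{_ : NonZero m}} → iter σ m i₀ ≡ i₀ → ∀ l → iter σ l i₀ ≡ iter σ (l ℕ.% m) i₀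
  iter-% {m} fixed l = begin
    iter σ l i₀                                      ≡⟨ cong (λ n → iter σ n i₀) (ℕ.m≡m%n+[m/n]*n l m) ⟩
    iter σ (l ℕ.% m ℕ.+ l ℕ./ m ℕ.* m) i₀            ≡⟨ iter-+ σ (l ℕ.% m) _ i₀ ⟨
    iter σ (l ℕ.% m) (iter σ (l ℕ./ m ℕ.* m) i₀)     ≡⟨ cong (iter σ (l ℕ.% m)) (multiple (l ℕ./ m)) ⟩
    iter σ (l ℕ.% m) i₀                              ∎
    where
    open ≡-Reasoning
    multiple : ∀ a → iter σ (a ℕ.* m) i₀ ≡ i₀
    multiple zero = refl
    multiple (suc a) = trans (sym (iter-+ σ m (a ℕ.* m) i₀)) (trans (cong (iter σ m) (multiple a)) fixed)

  -- If `i₀` returns after `m` steps, exponents matter only mod `m`, and `m` exponents must reach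
  -- all `d` points.
  period-≥ : ∀ {m} → 0 < m → iter σ m i₀ ≡ i₀ → d ≤ m
  period-≥ {m} 0<m fixed = injective⇒≤ exponent-inj
    where
    instance
      _ = ℕ.>-nonZero 0<m
    exponent : Fin d → Fin m
    exponent j = fromℕ< (ℕ.m%n<n (proj₁ (transitive j)) m)
    iter-exponent : ∀ j → iter σ (toℕ (exponent j)) i₀ ≡ j
    iter-exponent j = begin
      iter σ (toℕ (exponent j)) i₀          ≡⟨ cong (λ n → iter σ n i₀) (toℕ-fromℕ< (ℕ.m%n<n (proj₁ (transitive j)) m)) ⟩
      iter σ (proj₁ (transitive j) ℕ.% m) i₀ ≡⟨ iter-% fixed (proj₁ (transitive j)) ⟨
      iter σ (proj₁ (transitive j)) i₀      ≡⟨ proj₂ (transitive j) ⟩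
      j                                     ∎
      where open ≡-Reasoning
    exponent-inj : Inj exponent
    exponent-inj {j} {k} eq =
      trans (sym (iter-exponent j)) (trans (cong (λ e → iter σ (toℕ e) i₀) eq) (iter-exponent k))

  position : Fin d → Fin d
  position k = iter σ (toℕ k) i₀

  no-early-return : ∀ {a b} → a < b → b < d → iter σ a i₀ ≢ iter σ b i₀
  no-early-return {a} {b} a<b b<d eq = ℕₚ.<⇒≱ b<d (ℕₚ.≤-trans
    (period-≥ (ℕₚ.m<n⇒0<n∸m a<b) (sym (iter-inj σ-inj a (begin
      iter σ a i₀                      ≡⟨ eq ⟩
      iter σ b i₀                      ≡⟨ cong (λ n → iter σ n i₀) (ℕₚ.m+[n∸m]≡n (ℕₚ.<⇒≤ a<b)) ⟨
      iter σ (a ℕ.+ (b ℕ.∸ a)) i₀      ≡⟨ iter-+ σ a (b ℕ.∸ a) i₀ ⟨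
      iter σ a (iter σ (b ℕ.∸ a) i₀)   ∎))))
    (ℕₚ.m∸n≤m b a))
    where open ≡-Reasoning

  position-inj : Inj position
  position-inj {j} {k} eq with ℕₚ.<-cmp (toℕ j) (toℕ k)
  ... | tri< j<k _ _ = contradiction eq (no-early-return j<k (toℕ<n k))
  ... | tri≈ _ j≡k _ = toℕ-injective j≡k
  ... | tri> _ _ k<j = contradiction (sym eq) (no-early-return k<j (toℕ<n j))

  position-surj : ∀ j → ∃ λ k → position k ≡ j
  position-surj = inj⇒surj position position-inj

  -- The point after `d` steps already occurred at some step k < d. If k were positive, cancelling k
  -- steps would give a return after d - k steps, too early.
  iter-d : iter σ d i₀ ≡ i₀
  iter-d with position-surj (iter σ d i₀)
  ... | zero , eq = sym eq
  ... | k@(suc _) , eq = contradiction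
    (period-≥ (ℕₚ.m<n⇒0<n∸m (toℕ<n k)) (sym returns))
    (ℕₚ.<⇒≱ (ℕₚ.∸-monoʳ-< (ℕ.s≤s ℕ.z≤n) (ℕₚ.<⇒≤ (toℕ<n k))))
    where
    returns : i₀ ≡ iter σ (d ℕ.∸ toℕ k) i₀
    returns = iter-inj σ-inj (toℕ k) (trans eq (trans
      (cong (λ n → iter σ n i₀) (sym (ℕₚ.m+[n∸m]≡n (ℕₚ.<⇒≤ (toℕ<n k)))))
      (sym (iter-+ σ (toℕ k) _ i₀))))

  return⇒multiple : ∀ k → iter σ k i₀ ≡ i₀ → ∃ λ a → k ≡ a ℕ.* d
  return⇒multiple k fixed = k ℕ./ d , (begin
    k                              ≡⟨ ℕ.m≡m%n+[m/n]*n k d ⟩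
    k ℕ.% d ℕ.+ k ℕ./ d ℕ.* d      ≡⟨ cong (ℕ._+ k ℕ./ d ℕ.* d) remainder ⟩
    k ℕ./ d ℕ.* d                  ∎)
    where
    open ≡-Reasoning
    instance
      d≢0 : NonZero d
      d≢0 = ℕ.>-nonZero (ℕₚ.≤-<-trans ℕ.z≤n (toℕ<n i₀))
    remainder : k ℕ.% d ≡ 0
    remainder with k ℕ.% d in eq
    ... | zero = refl
    ... | suc r = contradiction
      (period-≥ (ℕ.s≤s ℕ.z≤n) (trans (cong (λ n → iter σ n i₀) (sym eq)) (trans (sym (iter-% iter-d k)) fixed)))
      (ℕₚ.<⇒≱ (subst (_< d) eq (ℕ.m%n<n k d)))

-- Coordinatewise automorphisms and transported maps

coordinatewise : ∀ {d q} (p p⁻ : Fin d → Fin d) → (∀ j → p (p⁻ j) ≡ j) → (∀ k → p⁻ (p k) ≡ k) →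
  (ψ ψ⁻ : Fin d → Fin q → Fin q) → (∀ k c → ψ k (ψ⁻ k c) ≡ c) → (∀ k c → ψ⁻ k (ψ k c) ≡ c) →
  Σ (GraphAut d q) λ φ → ∀ s k → lookup (to φ s) (p k) ≡ ψ k (lookup s k)
coordinatewise {d} {q} p p⁻ pp⁻ p⁻p ψ ψ⁻ ψψ⁻ ψ⁻ψ = record
  { to = Φ ; from = Φ⁻
  ; to-from = λ v → vec-ext λ j → begin
      lookup (Φ (Φ⁻ v)) j             ≡⟨ cong (lookup (Φ (Φ⁻ v))) (pp⁻ j) ⟨
      lookup (Φ (Φ⁻ v)) (p (p⁻ j))    ≡⟨ Φ-p (Φ⁻ v) (p⁻ j) ⟩
      ψ (p⁻ j) (lookup (Φ⁻ v) (p⁻ j)) ≡⟨ cong (ψ (p⁻ j)) (Φ⁻-lookup v (p⁻ j)) ⟩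
      ψ (p⁻ j) (ψ⁻ (p⁻ j) _)          ≡⟨ ψψ⁻ (p⁻ j) _ ⟩
      lookup v (p (p⁻ j))             ≡⟨ cong (lookup v) (pp⁻ j) ⟩
      lookup v j                      ∎
  ; from-to = λ s → vec-ext λ k →
      trans (Φ⁻-lookup (Φ s) k) (trans (cong (ψ⁻ k) (Φ-p s k)) (ψ⁻ψ k _))
  ; to-adj = λ v w (k , ne , eq) → p k
      , (λ e → ne (ψ-inj k (trans (sym (Φ-p v k)) (trans e (Φ-p w k)))))
      , λ j j≢ → begin
          lookup (Φ v) j                  ≡⟨ lookup∘tabulate _ j ⟩
          ψ (p⁻ j) (lookup v (p⁻ j))      ≡⟨ cong (ψ (p⁻ j)) (eq (p⁻ j) (λ e → j≢ (trans (sym (pp⁻ j)) (cong p e)))) ⟩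
          ψ (p⁻ j) (lookup w (p⁻ j))      ≡⟨ lookup∘tabulate _ j ⟨
          lookup (Φ w) j                  ∎
  ; from-adj = λ v w (j , ne , eq) → p⁻ j
      , (λ e → ne (begin
          lookup v j              ≡⟨ cong (lookup v) (pp⁻ j) ⟨
          lookup v (p (p⁻ j))     ≡⟨ ψ⁻-inj (p⁻ j) (trans (sym (Φ⁻-lookup v (p⁻ j))) (trans e (Φ⁻-lookup w (p⁻ j)))) ⟩
          lookup w (p (p⁻ j))     ≡⟨ cong (lookup w) (pp⁻ j) ⟩
          lookup w j              ∎))
      , λ k k≢ → trans (Φ⁻-lookup v k)
          (trans (cong (ψ⁻ k) (eq (p k) (λ e → k≢ (trans (sym (p⁻p k)) (cong p⁻ e)))))
            (sym (Φ⁻-lookup w k)))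
  } , Φ-p
  where
  open ≡-Reasoning
  Φ Φ⁻ : Vert d q → Vert d q
  Φ s = tabulate λ j → ψ (p⁻ j) (lookup s (p⁻ j))
  Φ⁻ v = tabulate λ k → ψ⁻ k (lookup v (p k))
  Φ-p : ∀ s k → lookup (Φ s) (p k) ≡ ψ k (lookup s k)
  Φ-p s k = trans (lookup∘tabulate _ (p k)) (cong (λ k → ψ k (lookup s k)) (p⁻p k))
  Φ⁻-lookup : ∀ v k → lookup (Φ⁻ v) k ≡ ψ⁻ k (lookup v (p k))
  Φ⁻-lookup v k = lookup∘tabulate _ k
  ψ-inj : ∀ k → Inj (ψ k)
  ψ-inj k {a} {b} e = trans (sym (ψ⁻ψ k a)) (trans (cong (ψ⁻ k) e) (ψ⁻ψ k b))
  ψ⁻-inj : ∀ k → Inj (ψ⁻ k)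
  ψ⁻-inj k {a} {b} e = trans (sym (ψψ⁻ k a)) (trans (cong (ψ k) e) (ψψ⁻ k b))

graphAut-inverse : ∀ {d q} → GraphAut d q → GraphAut d q
graphAut-inverse φ = record
  { to = from φ ; from = to φ ; to-from = from-to φ ; from-to = to-from φ
  ; to-adj = from-adj φ ; from-adj = to-adj φ }

pullback : ∀ {d q} (M : RotationSystem d q) (φ : GraphAut d q) → RotationSystem d q
pullback {d} {q} M φ = record
  { ρ = ρ′
  ; ρ-adj = λ v w a → subst (λ u → Adj u (ρ′ v w)) (from-to φ v)
      (from-adj φ _ _ (ρ-adj M _ _ (to-adj φ v w a)))
  ; ρ-inj = λ v w w′ a a′ eq → to-inj (ρ-inj M _ _ _ (to-adj φ v w a) (to-adj φ v w′ a′) (from-inj eq))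
  ; ρ-cyc = cyc }
  where
  ρ′ : Vert d q → Vert d q → Vert d q
  ρ′ v w = from φ (ρ M (to φ v) (to φ w))
  to-inj : Inj (to φ)
  to-inj {v} {w} eq = trans (sym (from-to φ v)) (trans (cong (from φ) eq) (from-to φ w))
  from-inj : Inj (from φ)
  from-inj {v} {w} eq = trans (sym (to-from φ v)) (trans (cong (to φ) eq) (to-from φ w))
  iter-ρ′ : ∀ v w k → to φ (iter (ρ′ v) k w) ≡ iter (ρ M (to φ v)) k (to φ w)
  iter-ρ′ v w zero = refl
  iter-ρ′ v w (suc k) = trans (to-from φ _) (cong (ρ M (to φ v)) (iter-ρ′ v w k))
  cyc : ∀ v w w′ → Adj v w → Adj v w′ → ∃ λ k → iter (ρ′ v) k w ≡ w′
  cyc v w w′ a a′ with ρ-cyc M (to φ v) (to φ w) (to φ w′) (to-adj φ v w a) (to-adj φ v w′ a′)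
  ... | k , eq = k , to-inj (trans (iter-ρ′ v w k) eq)

pullback-iso : ∀ {d q} (M : RotationSystem d q) (φ : GraphAut d q) → MapIso M (pullback M φ)
pullback-iso M φ = graphAut-inverse φ , λ v w _ →
  cong (from φ) (sym (cong₂ (ρ M) (to-from φ v) (to-from φ w)))

-- Coordinates in which the rotation becomes M_ω

module Coordinates {n q : ℕ} (2<q : 2 < q) (1<q : 1 < q) (M : RotationSystem (suc n) q)
  (regular : OrientablyRegular M) (v₀ : Vert (suc n) q)
  (A : AffineField (Regular.line-sharply2Transitive 1<q M regular v₀ zero)) where

  i₀ : Fin (suc n)
  i₀ = zero

  d : ℕ
  d = suc n

  open LineTranslations 2<q 1<q M regular v₀ i₀ A
  open CyclicPermutation (π x) (D.π-inj x) i₀ (πx-transitive i₀)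

  xᵈ : LineStabilizer
  xᵈ = pow d , preservesLine (pow d) {𝟘} {𝟘} (trans (π-pow d i₀) iter-d)
    (trans (cong (pow d ▹_) K-𝟘) (trans (pow-v₀ d) (sym K-𝟘)))

  xᵈ-𝟘 : xᵈ · 𝟘 ≡ 𝟘
  xᵈ-𝟘 = cong (λ v → lookup v i₀) (trans (cong (pow d ▹_) K-𝟘) (pow-v₀ d))

  ω : Fin q
  ω = xᵈ · 𝟙

  xᵈ-ω : ∀ c → pow d ▹ K c ≡ K (ω * c)
  xᵈ-ω c = trans (proj₂ xᵈ c) (cong K (stabilizer-scales xᵈ xᵈ-𝟘 c))

  -- Some power of `x` takes `K 𝟙` to `K y`. It fixes direction `i₀`, so its exponent is a multiple
  -- a d, and then y is the a-th power of ω.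
  ω-generator : IsGenerator F ω
  ω-generator = ω≢0 , generates
    where
    ω≢0 : ω ≢ 0#
    ω≢0 eq = 𝟘≢𝟙 (·-inj xᵈ (trans xᵈ-𝟘 (sym (trans eq 0#≡𝟘))))
    multiple : ∀ a → iter (x ▹_) (a ℕ.* d) (K 𝟙) ≡ K (FieldOn._^′_ F ω a)
    multiple zero = cong K (sym 1#≡𝟙)
    multiple (suc a) = begin
      iter (x ▹_) (d ℕ.+ a ℕ.* d) (K 𝟙)              ≡⟨ iter-+ (x ▹_) d (a ℕ.* d) (K 𝟙) ⟨
      iter (x ▹_) d (iter (x ▹_) (a ℕ.* d) (K 𝟙))    ≡⟨ cong (iter (x ▹_) d) (multiple a) ⟩
      iter (x ▹_) d (K (FieldOn._^′_ F ω a))         ≡⟨ pow-▹ d _ ⟨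
      pow d ▹ K (FieldOn._^′_ F ω a)                 ≡⟨ xᵈ-ω _ ⟩
      K (ω * FieldOn._^′_ F ω a)                     ∎
      where open ≡-Reasoning
    v₀-K : ∀ {y} → y ≢ 0# → AdjAt i₀ v₀ (K y)
    v₀-K y≢0 = update-AdjAt v₀ i₀ λ eq → y≢0 (sym (trans 0#≡𝟘 eq))
    generates : ∀ y → y ≢ 0# → ∃ λ k → FieldOn._^′_ F ω k ≡ y
    generates y y≢0 with pow-transitive (K 𝟙) (K y) ⟪ v₀-K𝟙 ⟫ ⟪ v₀-K y≢0 ⟫
    ... | k , eq with return⇒multiple k (trans (sym (π-pow k i₀)) (AdjAt-unique
          (subst₂ (AdjAt (π (pow k) i₀)) (pow-v₀ k) eq (π-adjAt (pow k) v₀-K𝟙)) (v₀-K y≢0)))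
    ...   | a , refl = a , K-inj (trans (sym (multiple a)) (trans (sym (pow-▹ (a ℕ.* d) (K 𝟙))) eq))

  -- The chart of the k-th direction: the point `c` of the line is carried there by xᵏ and its
  -- coordinate is read off. The index is a natural number so that k = d is allowed; there the chart
  -- has come back to direction `i₀` and reads as multiplication by ω.
  ψ : ℕ → Fin q → Fin q
  ψ k c = lookup (pow k ▹ K c) (iter (π x) k i₀)

  ψ-inj : ∀ k → Inj (ψ k)
  ψ-inj k {a} {b} eq with a ≟ b
  ... | yes p = p
  ... | no a≢b = contradiction eq (differ
    (subst (λ j → AdjAt j (pow k ▹ K a) (pow k ▹ K b)) (π-pow k i₀) (π-adjAt (pow k) (K-AdjAt a≢b))))

  abstract
    coordinates : Σ (GraphAut d q) λ φ → ∀ s k → lookup (to φ s) (position k) ≡ ψ (toℕ k) (lookup s k)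
    coordinates = coordinatewise position (proj₁ ∘ position-surj) (proj₂ ∘ position-surj)
      (λ k → position-inj (proj₂ (position-surj (position k))))
      (ψ ∘ toℕ) (λ k → proj₁ ∘ ψ-surj k) (λ k c → proj₂ (ψ-surj k c))
      (λ k c → ψ-inj (toℕ k) (proj₂ (ψ-surj k _)))
      where
      ψ-surj : ∀ (k : Fin d) c → ∃ λ b → ψ (toℕ k) b ≡ c
      ψ-surj k = inj⇒surj (ψ (toℕ k)) (ψ-inj (toℕ k))

  Φ : Vert d q → Vert d q
  Φ = to (proj₁ coordinates)

  Φ-position : ∀ s k → lookup (Φ s) (position k) ≡ ψ (toℕ k) (lookup s k)
  Φ-position = proj₂ coordinates

  position-ext : ∀ {v w : Vert d q} → (∀ k → lookup v (position k) ≡ lookup w (position k)) → v ≡ w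
  position-ext {v} {w} eq = vec-ext λ j →
    subst (λ j → lookup v j ≡ lookup w j) (proj₂ (position-surj j)) (eq (proj₁ (position-surj j)))

  -- `Φ s` has the same coordinate in the k-th direction as a point of the line moved by xᵏ, and `x`
  -- acts coordinatewise.
  x-position : ∀ s k → lookup (x ▹ Φ s) (iter (π x) (suc (toℕ k)) i₀) ≡ ψ (suc (toℕ k)) (lookup s k)
  x-position s k = D.π-lookup x (Φ s) (pow (toℕ k) ▹ K (lookup s k)) (Φ-position s k)

  -- Each chart is the previous one followed by `x`, so an entry of `s` moves one place on
  -- unchanged. The last entry wraps around to chart `d`, which supplies the factor ω.
  x-Φ : ∀ s → x ▹ Φ s ≡ Φ (mulM F ω s)
  x-Φ s = position-ext go
    where
    open ≡-Reasoning
    go : ∀ k → lookup (x ▹ Φ s) (position k) ≡ lookup (Φ (mulM F ω s)) (position k)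
    go (suc k) = begin
      lookup (x ▹ Φ s) (iter (π x) (suc (toℕ k)) i₀)
        ≡⟨ cong (λ m → lookup (x ▹ Φ s) (iter (π x) (suc m) i₀)) (toℕ-inject₁ k) ⟨
      lookup (x ▹ Φ s) (iter (π x) (suc (toℕ (inject₁ k))) i₀)
        ≡⟨ x-position s (inject₁ k) ⟩
      ψ (suc (toℕ (inject₁ k))) (lookup s (inject₁ k))
        ≡⟨ cong₂ (λ m → ψ (suc m)) (toℕ-inject₁ k) (sym (lookup-init s k)) ⟩
      ψ (suc (toℕ k)) (lookup (init s) k)
        ≡⟨ Φ-position (mulM F ω s) (suc k) ⟨
      lookup (Φ (mulM F ω s)) (position (suc k)) ∎
    go zero = begin
      lookup (x ▹ Φ s) i₀
        ≡⟨ cong (lookup (x ▹ Φ s)) (trans (sym iter-d) (cong (λ m → iter (π x) (suc m) i₀) (sym (toℕ-fromℕ n)))) ⟩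
      lookup (x ▹ Φ s) (iter (π x) (suc (toℕ (fromℕ n))) i₀)
        ≡⟨ x-position s (fromℕ n) ⟩
      ψ (suc (toℕ (fromℕ n))) (lookup s (fromℕ n))
        ≡⟨ cong₂ (λ m → ψ (suc m)) (toℕ-fromℕ n) (sym (last-lookup s)) ⟩
      lookup (pow d ▹ K (last s)) (iter (π x) d i₀)
        ≡⟨ cong₂ lookup (xᵈ-ω (last s)) iter-d ⟩
      lookup (K (ω * last s)) i₀
        ≡⟨ Φ-position (mulM F ω s) zero ⟨
      lookup (Φ (mulM F ω s)) i₀ ∎

  elementary-translation : ∀ k a → ∃ λ (g : Aut) → ∀ s → g ▹ Φ s ≡ Φ (s [ k ]≔ (a + lookup s k))
  elementary-translation k a with translate a
  ... | T@(t , _) , t+ = y ∘ᴬ t ∘ᴬ y ⁻¹ᴬ , λ s → position-ext (go s)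
    where
    open ≡-Reasoning
    y : Aut
    y = pow (toℕ k)
    π-y : π y i₀ ≡ position k
    π-y = π-pow (toℕ k) i₀
    go : ∀ s j → lookup (y ▹ t ▹ y ⁻¹ᴬ ▹ Φ s) (position j) ≡
                 lookup (Φ (s [ k ]≔ (a + lookup s k))) (position j)
    go s j with j ≟ k
    ... | yes refl = begin
      lookup (y ▹ t ▹ y ⁻¹ᴬ ▹ Φ s) (position j)
        ≡⟨ subst (λ i → lookup (Φ s) i ≡ lookup (y ▹ K (lookup s j)) i →
             lookup (y ▹ t ▹ y ⁻¹ᴬ ▹ Φ s) i ≡ lookup (y ▹ K (a + lookup s j)) i)
             π-y (conjugate-translation-at y T t+ (Φ s)) (Φ-position s j) ⟩
      ψ (toℕ j) (a + lookup s j)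
        ≡⟨ cong (ψ (toℕ j)) (lookup∘update j s (a + lookup s j)) ⟨
      ψ (toℕ j) (lookup (s [ j ]≔ (a + lookup s j)) j)
        ≡⟨ Φ-position (s [ j ]≔ (a + lookup s j)) j ⟨
      lookup (Φ (s [ j ]≔ (a + lookup s j))) (position j) ∎
    ... | no j≢k with π-preimage y (position j)
    ...   | i , πi = begin
      lookup (y ▹ t ▹ y ⁻¹ᴬ ▹ Φ s) (position j)
        ≡⟨ subst (λ j → lookup (y ▹ t ▹ y ⁻¹ᴬ ▹ Φ s) j ≡ lookup (Φ s) j) πi
             (conjugate-translation-off y T t+ (Φ s) i≢i₀) ⟩
      lookup (Φ s) (position j)
        ≡⟨ Φ-position s j ⟩
      ψ (toℕ j) (lookup s j)
        ≡⟨ cong (ψ (toℕ j)) (lookup∘update′ j≢k s (a + lookup s k)) ⟨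
      ψ (toℕ j) (lookup (s [ k ]≔ (a + lookup s k)) j)
        ≡⟨ Φ-position (s [ k ]≔ (a + lookup s k)) j ⟨
      lookup (Φ (s [ k ]≔ (a + lookup s k))) (position j) ∎
      where
      i≢i₀ : i ≢ i₀
      i≢i₀ refl = j≢k (position-inj (trans (sym πi) π-y))

  0v : Vert d q
  0v = replicate d 0#

  lookup-vadd : ∀ (u v : Vert d q) k → lookup (vadd F u v) k ≡ lookup u k + lookup v k
  lookup-vadd u v k = lookup-zipWith _+_ k u v

  lookup-vsub : ∀ (u v : Vert d q) k → lookup (vsub F u v) k ≡ lookup u k + - lookup v k
  lookup-vsub u v k = trans (lookup-zipWith _+_ k u _) (cong (lookup u k +_) (lookup-map k -_ v))

  vadd-0v : ∀ v → vadd F v 0v ≡ v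
  vadd-0v v = vec-ext λ k →
    trans (lookup-vadd v 0v k) (trans (cong (lookup v k +_) (lookup-replicate k 0#)) (+-identityʳ _))

  0v-vadd : ∀ v → vadd F 0v v ≡ v
  0v-vadd v = vec-ext λ k →
    trans (lookup-vadd 0v v k) (trans (cong (_+ lookup v k) (lookup-replicate k 0#)) (+-identityˡ _))

  vadd-vsub : ∀ v w → vadd F v (vsub F w v) ≡ w
  vadd-vsub v w = vec-ext λ k → begin
    lookup (vadd F v (vsub F w v)) k             ≡⟨ lookup-vadd v _ k ⟩
    lookup v k + lookup (vsub F w v) k           ≡⟨ cong (lookup v k +_) (lookup-vsub w v k) ⟩
    lookup v k + (lookup w k + - lookup v k)     ≡⟨ +-comm (lookup v k) _ ⟩
    lookup w k + - lookup v k + lookup v k       ≡⟨ +-assoc (lookup w k) _ _ ⟩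
    lookup w k + (- lookup v k + lookup v k)     ≡⟨ cong (lookup w k +_) (-‿inverseˡ _) ⟩
    lookup w k + 0#                              ≡⟨ +-identityʳ _ ⟩
    lookup w k                                   ∎
    where open ≡-Reasoning

  translation : ∀ a → ∃ λ (g : Aut) → ∀ s → g ▹ Φ s ≡ Φ (vadd F a s)
  translation = vertex-induction _ {0v} (idᴬ , λ s → cong Φ (sym (0v-vadd s))) step
    where
    open ≡-Reasoning
    step : ∀ a k c → (∃ λ (g : Aut) → ∀ s → g ▹ Φ s ≡ Φ (vadd F a s)) →
      ∃ λ (g : Aut) → ∀ s → g ▹ Φ s ≡ Φ (vadd F (a [ k ]≔ c) s)
    -- Overwriting the k-th entry of `a` by `c` amounts to adding the difference of `c` and that
    -- entry in direction `k`.
    step a k c (g , g-Φ) with elementary-translation k (c + - lookup a k)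
    ... | e , e-Φ = e ∘ᴬ g , λ s → begin
      e ▹ g ▹ Φ s           ≡⟨ cong (e ▹_) (g-Φ s) ⟩
      e ▹ Φ (vadd F a s)    ≡⟨ e-Φ (vadd F a s) ⟩
      Φ _                   ≡⟨ cong Φ (vec-ext (go s)) ⟩
      Φ (vadd F (a [ k ]≔ c) s) ∎
      where
      go : ∀ s j → lookup (vadd F a s [ k ]≔ (c + - lookup a k + lookup (vadd F a s) k)) j
                   ≡ lookup (vadd F (a [ k ]≔ c) s) j
      go s j with j ≟ k
      ... | no j≢k = begin
        lookup (vadd F a s [ k ]≔ _) j                   ≡⟨ lookup∘update′ j≢k (vadd F a s) _ ⟩
        lookup (vadd F a s) j                            ≡⟨ lookup-vadd a s j ⟩
        lookup a j + lookup s j                          ≡⟨ cong (_+ lookup s j) (lookup∘update′ j≢k a c) ⟨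
        lookup (a [ k ]≔ c) j + lookup s j               ≡⟨ lookup-vadd (a [ k ]≔ c) s j ⟨
        lookup (vadd F (a [ k ]≔ c) s) j                 ∎
      ... | yes refl = begin
        lookup (vadd F a s [ j ]≔ _) j                   ≡⟨ lookup∘update j (vadd F a s) _ ⟩
        c + - lookup a j + lookup (vadd F a s) j         ≡⟨ cong (c + - lookup a j +_) (lookup-vadd a s j) ⟩
        c + - lookup a j + (lookup a j + lookup s j)     ≡⟨ +-assoc _ (lookup a j) (lookup s j) ⟨
        c + - lookup a j + lookup a j + lookup s j       ≡⟨ cong (_+ lookup s j) (+-assoc c _ _) ⟩
        c + (- lookup a j + lookup a j) + lookup s j     ≡⟨ cong (λ z → c + z + lookup s j) (-‿inverseˡ _) ⟩
        c + 0# + lookup s j                              ≡⟨ cong (_+ lookup s j) (+-identityʳ c) ⟩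
        c + lookup s j                                   ≡⟨ cong (_+ lookup s j) (lookup∘update j a c) ⟨
        lookup (a [ j ]≔ c) j + lookup s j               ≡⟨ lookup-vadd (a [ j ]≔ c) s j ⟨
        lookup (vadd F (a [ j ]≔ c) s) j                 ∎

  Φ-0v : Φ 0v ≡ v₀
  Φ-0v = position-ext λ k → begin
    lookup (Φ 0v) (position k)              ≡⟨ Φ-position 0v k ⟩
    ψ (toℕ k) (lookup 0v k)                 ≡⟨ cong (ψ (toℕ k)) (trans (lookup-replicate k 0#) 0#≡𝟘) ⟩
    lookup (pow (toℕ k) ▹ K 𝟘) (position k) ≡⟨ cong (λ v → lookup (pow (toℕ k) ▹ v) (position k)) K-𝟘 ⟩
    lookup (pow (toℕ k) ▹ v₀) (position k)  ≡⟨ cong (λ v → lookup v (position k)) (pow-v₀ (toℕ k)) ⟩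
    lookup v₀ (position k)                  ∎
    where open ≡-Reasoning

  -- A translation automorphism carries `v₀` to `Φ v`, reducing the rotation at `Φ v` to the one at
  -- `v₀`, which is the action of `x`.
  Φ-ρ : ∀ v w → Adj v w → ρ M (Φ v) (Φ w) ≡ Φ (hammingRot F ω v w)
  Φ-ρ v w a with translation v
  ... | g , g-Φ = begin
    ρ M (Φ v) (Φ w)                  ≡⟨ cong₂ (ρ M) g-v₀ g-Φδ ⟨
    ρ M (g ▹ v₀) (g ▹ Φ δ)           ≡⟨ ▹-ρ g v₀ (Φ δ) v₀-Φδ ⟨
    g ▹ ρ M v₀ (Φ δ)                 ≡⟨ cong (g ▹_) (x-ρ (Φ δ) v₀-Φδ) ⟨
    g ▹ x ▹ Φ δ                      ≡⟨ cong (g ▹_) (x-Φ δ) ⟩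
    g ▹ Φ (mulM F ω δ)               ≡⟨ g-Φ _ ⟩
    Φ (hammingRot F ω v w)           ∎
    where
    open ≡-Reasoning
    δ = vsub F w v
    g-v₀ : g ▹ v₀ ≡ Φ v
    g-v₀ = trans (cong (g ▹_) (sym Φ-0v)) (trans (g-Φ 0v) (cong Φ (vadd-0v v)))
    g-Φδ : g ▹ Φ δ ≡ Φ w
    g-Φδ = trans (g-Φ δ) (cong Φ (vadd-vsub v w))
    v₀-Φδ : Adj v₀ (Φ δ)
    v₀-Φδ = D.g-Adj⁻ g v₀ (Φ δ) (subst₂ Adj (sym g-v₀) (sym g-Φδ) (to-adj (proj₁ coordinates) v w a))

  is-hamming : IsHammingMap F ω (pullback M (proj₁ coordinates))
  is-hamming = record { rot-eq = λ v w a →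
    trans (cong (from (proj₁ coordinates)) (Φ-ρ v w a)) (from-to (proj₁ coordinates) _) }

-- The classification and the order q

hamming-classification : ∀ {n q} → 2 < q → (M : RotationSystem (suc n) q) → OrientablyRegular M →
  Σ (FieldOn q) λ F → Σ (Fin q) λ ω → IsGenerator F ω ×
    Σ (RotationSystem (suc n) q) λ H → IsHammingMap F ω H × MapIso M H
hamming-classification {n} {q} 2<q M regular =
  AffineField.F A , C.ω , C.ω-generator ,
    pullback M (proj₁ C.coordinates) , C.is-hamming , pullback-iso M (proj₁ C.coordinates)
  where
  1<q : 1 < q
  1<q = ℕₚ.<-trans (ℕₚ.n<1+n 1) 2<q
  v₀ : Vert (suc n) q
  v₀ = replicate (suc n) (fromℕ< 1<q)
  A = affineField (Regular.line-sharply2Transitive 1<q M regular v₀ zero)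
  module C = Coordinates 2<q 1<q M regular v₀ A

theorem2p1 : (d q : ℕ) → 1 ≤ d → 2 ≤ q → (M : RotationSystem d q) → OrientablyRegular M →
    IsPrimePower q ×
    (2 < q → Σ (FieldOn q) λ F → Σ _ λ ω → IsGenerator F ω ×
    Σ (RotationSystem d q) λ H → IsHammingMap F ω H × MapIso M H)
theorem2p1 (suc n) q 1≤d 2≤q M regular = prime-power (ℕₚ.m≤n⇒m<n∨m≡n 2≤q) , classification
  where
  classification : 2 < q → _
  classification 2<q = hamming-classification 2<q M regular
  prime-power : 2 < q ⊎ 2 ≡ q → IsPrimePower q
  prime-power (inj₁ 2<q) = field-order (proj₁ (classification 2<q))
  prime-power (inj₂ refl) = 2 , 1 , prime[2] , refl
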